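{- Let $G$ be a graph with $n$ vertices, and let $b,\Delta,a,m$ be non-negative integers with $b-\Delta\ge a\ge 2$, $\delta(G)\ge\frac{(\Delta+a)n}{b+2a+\Delta}+\frac{b(b-\Delta)}{a+\Delta}+m$ and $n>\frac{(b+2m+a-2)(b+\Delta+2a)}{\Delta+a}$. Let $g,f$ be integer-valued functions on $V(G)$ with $b-\Delta\ge f(x)-\Delta\ge g(x)\ge a$ for every vertex $x$. If $\sigma_2(G)\ge\frac{2(b+a)n}{b+2a+\Delta}$, then $G$ is fractional ID-$(g,f,m)$-deleted.
   Context: All graphs are finite and simple; $\delta(G)$ is the minimum degree and $\sigma_2(G)=\min\{d_G(u)+d_G(v): u\ne v,\ uv\notin E(G)\}$. For integer-valued functions $g\le f$ on $V(G)$, a fractional $(g,f)$-factor of $G$ is a function $h:E(G)\to[0,1]$ such that $g(x)\le\sum_{e\ni x}h(e)\le f(x)$ for every vertex $x$. $G$ is fractional $(g,f,m)$-deleted if for every $H\subseteq E(G)$ with $|H|=m$, $G-H$ has a fractional $(g,f)$-factor. $G$ is fractional ID-$(g,f,m)$-deleted if for every independent set $I\subseteq V(G)$, $G-I$ is fractional $(g,f,m)$-deleted (with $g,f$ restricted to $V(G)\setminus I$). -}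

module Defs where

open import Data.Bool using (Bool; true; false; if_then_else_; _∧_; not)
open import Data.Nat as ℕ using (ℕ; zero; suc; _<_)
open import Data.Nat.Properties using (_<?_)
open import Data.Fin using (Fin; toℕ)
open import Data.Integer as ℤ using (ℤ; +_)
open import Data.Rational as ℚ using (ℚ; 0ℚ; 1ℚ)
open import Data.Product using (_×_; Σ; _,_)
open import Relation.Binary.PropositionalEquality using (_≡_)
open import Relation.Nullary.Decidable using (⌊_⌋)

record Graph (n : ℕ) : Set where
  field
    adj   : Fin n → Fin n → Bool
    sym   : ∀ u v → adj u v ≡ adj v u
    irrefl : ∀ v → adj v v ≡ false
open Graph public

sumℕ : ∀ {n} → (Fin n → ℕ) → ℕ
sumℕ {zero}  f = 0
sumℕ {suc n} f = f Data.Fin.zero ℕ.+ sumℕ (λ i → f (Data.Fin.suc i))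

sumℚ : ∀ {n} → (Fin n → ℚ) → ℚ
sumℚ {zero}  f = 0ℚ
sumℚ {suc n} f = f Data.Fin.zero ℚ.+ sumℚ (λ i → f (Data.Fin.suc i))

count : ∀ {n} → (Fin n → Bool) → ℕ
count p = sumℕ (λ i → if p i then 1 else 0)

deg : ∀ {n} → Graph n → Fin n → ℕ
deg G v = count (adj G v)

VSet : ℕ → Set
VSet n = Fin n → Bool

Independent : ∀ {n} → Graph n → VSet n → Set
Independent G I = ∀ u v → I u ≡ true → I v ≡ true → adj G u v ≡ false

-- Edge subsets of a graph on Fin n: symmetric Bool-valued relations
-- (an edge {u,v} is recorded as H u v ≡ H v u ≡ true).
ESet : ℕ → Set
ESet n = Fin n → Fin n → Bool

adjMinusI : ∀ {n} → Graph n → VSet n → Fin n → Fin n → Bool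
adjMinusI G I u v = not (I u) ∧ not (I v) ∧ adj G u v

EdgeSubset : ∀ {n} → Graph n → VSet n → ESet n → Set
EdgeSubset G I H = (∀ u v → H u v ≡ H v u) × (∀ u v → H u v ≡ true → adjMinusI G I u v ≡ true)

-- number of edges in H (unordered pairs {u,v}, counted once via toℕ u < toℕ v)
edgeCount : ∀ {n} → ESet n → ℕ
edgeCount H = sumℕ (λ u → count (λ v → ⌊ toℕ u <? toℕ v ⌋ ∧ H u v))

adjDel : ∀ {n} → Graph n → VSet n → ESet n → Fin n → Fin n → Bool
adjDel G I H u v = adjMinusI G I u v ∧ not (H u v)

-- A fractional (g,f)-factor of (G − I) − H: h assigns to each edge uv
-- (h symmetric, so a function on unordered edges) a value in [0,1], and
-- for each vertex x of G − I, g x ≤ Σ_{e ∋ x} h e ≤ f x.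
HasFractionalFactorDel : ∀ {n} → Graph n → VSet n → ESet n →
                         (g f : Fin n → ℤ) → Set
HasFractionalFactorDel {n} G I H g f =
  Σ (Fin n → Fin n → ℚ) λ h →
    (∀ u v → adjDel G I H u v ≡ true → h u v ≡ h v u) ×
    (∀ u v → adjDel G I H u v ≡ true → (0ℚ ℚ.≤ h u v) × (h u v ℚ.≤ 1ℚ)) ×
    (∀ x → I x ≡ false →
       let s = sumℚ (λ v → if adjDel G I H x v then h x v else 0ℚ) in
       ((g x ℚ./ 1) ℚ.≤ s) × (s ℚ.≤ (f x ℚ./ 1)))

FractionalDeletedMinus : ∀ {n} → Graph n → VSet n → (g f : Fin n → ℤ) → ℕ → Set
FractionalDeletedMinus {n} G I g f m =
  (H : ESet n) → EdgeSubset G I H → edgeCount H ≡ m → HasFractionalFactorDel G I H g f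

FractionalIDDeleted : ∀ {n} → Graph n → (g f : Fin n → ℤ) → ℕ → Set
FractionalIDDeleted {n} G g f m =
  (I : VSet n) → Independent G I → FractionalDeletedMinus G I g f m

{-# OPTIONS --safe #-}

-- Write p = a + Δ, q = b − Δ and N = b + 2a + Δ = 2p + q.  Splitting every edge
-- into two arcs, a fractional factor of G − I − H is obtained as (M + Mᵀ)/2 from
-- a 0/1 matrix M supported on the edges whose row and column sums lie in [g, f],
-- and augmenting along alternating paths yields such an M unless some disjoint
-- S, T satisfy f(S) + Σ_T h < g(T), where h(x) counts the neighbours of x outside
-- S; one may take T = {x ∉ S : h(x) < g(x)}.  Suppose such a pair exists and put
-- D(x) = h(x) + deg_H(x).
--
-- The Ore condition gives |I| ≤ pn/N, hence p(|S| + D(x)) ≥ bq + pm on T by the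
-- minimum degree condition.  Let u ∈ T minimise D.  This bound already refutes
-- D(u) ≥ q, and also D(u) < q when all x ∈ T outside the closed neighbourhood of
-- u have D(x) ≥ q, since at most D(u) + 1 vertices of T lie inside it.  Otherwise
-- let v minimise D on T outside that neighbourhood.  The Ore condition for u, v
-- bounds |S| from below, |I| + |S| + |T| ≤ n bounds it from above, and the lower
-- bound on n makes the two incompatible.

module Submission where

open import Defs
open import Data.Bool using (Bool; true; false; if_then_else_; _∧_; _∨_; not)
open import Data.Bool.Properties as Bool using ()
open import Data.Empty using (⊥; ⊥-elim)
open import Data.Fin using (Fin; zero; suc; toℕ)
open import Data.Fin.Properties as Fin using (any?)
open import Data.Integer as ℤ using (ℤ; +_)
import Data.Integer.Properties as ℤ
open import Data.Nat using (ℕ; zero; suc; _+_; _*_; _∸_; _≤_; _<_; _<ᵇ_; z≤n; s≤s; s≤s⁻¹)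
open import Data.Nat.Induction using (<-wellFounded)
open import Data.Nat.Properties
open import Data.Nat.Tactic.RingSolver using (solve-∀)
open import Data.Product using (_×_; ∃; _,_; proj₁; proj₂)
open import Data.Rational as ℚ using (ℚ; 0ℚ)
import Data.Rational.Properties as ℚ
open import Data.Rational.Unnormalised as ℚᵘ using (mkℚᵘ; *≡*; *≤*)
import Data.Rational.Unnormalised.Properties as ℚᵘ
open import Data.Sum using (_⊎_; inj₁; inj₂)
open import Induction.WellFounded using (Acc; acc)
open import Relation.Binary.Definitions using (tri<; tri≈; tri>)
open import Relation.Binary.PropositionalEquality using (_≡_; _≢_; refl; trans; cong; cong₂; subst; subst₂) renaming (sym to ≡-sym)
open import Relation.Nullary using (Dec; yes; no; does)
open import Relation.Nullary.Decidable using (_×-dec_; ⌊_⌋; ¬?)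
open import Relation.Nullary.Reflects using (ofʸ; ofⁿ)

private variable
  n : ℕ

-- Finite sums

⟦_⟧ : Bool → ℕ
⟦ b ⟧ = if b then 1 else 0

sumOn : VSet n → (Fin n → ℕ) → ℕ
sumOn T f = sumℕ (λ x → if T x then f x else 0)

sumℕ-mono : {f g : Fin n → ℕ} → (∀ i → f i ≤ g i) → sumℕ f ≤ sumℕ g
sumℕ-mono {zero}  f≤g = z≤n
sumℕ-mono {suc n} f≤g = +-mono-≤ (f≤g zero) (sumℕ-mono (λ i → f≤g (suc i)))

sumℕ-cong : {f g : Fin n → ℕ} → (∀ i → f i ≡ g i) → sumℕ f ≡ sumℕ g
sumℕ-cong f≡g =
  ≤-antisym (sumℕ-mono (λ i → ≤-reflexive (f≡g i))) (sumℕ-mono (λ i → ≤-reflexive (≡-sym (f≡g i))))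

sumℕ-mono-< : {f g : Fin n → ℕ} → (∀ i → f i ≤ g i) → ∀ j → f j < g j → sumℕ f < sumℕ g
sumℕ-mono-< f≤g zero    fj<gj = +-mono-<-≤ fj<gj (sumℕ-mono (λ i → f≤g (suc i)))
sumℕ-mono-< f≤g (suc j) fj<gj = +-mono-≤-< (f≤g zero) (sumℕ-mono-< (λ i → f≤g (suc i)) j fj<gj)

sumℕ-0 : ∀ n → sumℕ {n} (λ _ → 0) ≡ 0
sumℕ-0 zero    = refl
sumℕ-0 (suc n) = sumℕ-0 n

sumℕ-1 : ∀ n → sumℕ {n} (λ _ → 1) ≡ n
sumℕ-1 zero    = refl
sumℕ-1 (suc n) = cong suc (sumℕ-1 n)

sumℕ-+ : (f g : Fin n → ℕ) → sumℕ (λ i → f i + g i) ≡ sumℕ f + sumℕ g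
sumℕ-+ {zero}  f g = refl
sumℕ-+ {suc n} f g
  rewrite sumℕ-+ (λ i → f (suc i)) (λ i → g (suc i)) = interchange (f zero) (g zero) _ _
  where
  interchange : ∀ a b c d → a + b + (c + d) ≡ a + c + (b + d)
  interchange = solve-∀

sumℕ-*ˡ : ∀ c (f : Fin n → ℕ) → sumℕ (λ i → c * f i) ≡ c * sumℕ f
sumℕ-*ˡ {zero}  c f = ≡-sym (*-zeroʳ c)
sumℕ-*ˡ {suc n} c f
  rewrite sumℕ-*ˡ c (λ i → f (suc i)) = ≡-sym (*-distribˡ-+ c (f zero) _)

sumℕ-swap : ∀ {k n} (f : Fin k → Fin n → ℕ) →
            sumℕ (λ i → sumℕ (f i)) ≡ sumℕ (λ j → sumℕ (λ i → f i j))
sumℕ-swap {zero}  {n} f = ≡-sym (sumℕ-0 n)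
sumℕ-swap {suc k}     f
  rewrite sumℕ-swap (λ i → f (suc i)) = ≡-sym (sumℕ-+ (f zero) _)

term≤sumℕ : (f : Fin n → ℕ) → ∀ j → f j ≤ sumℕ f
term≤sumℕ f zero    = m≤m+n _ _
term≤sumℕ f (suc j) = ≤-trans (term≤sumℕ (λ i → f (suc i)) j) (m≤n+m _ _)

sumOn-const : (T : VSet n) → ∀ c → sumOn T (λ _ → c) ≡ c * count T
sumOn-const T c = trans (sumℕ-cong pointwise) (sumℕ-*ˡ c (λ x → ⟦ T x ⟧))
  where
  pointwise : ∀ x → (if T x then c else 0) ≡ c * ⟦ T x ⟧
  pointwise x with T x
  ... | true  = ≡-sym (*-identityʳ c)
  ... | false = ≡-sym (*-zeroʳ c)

sumOn-+ : (T : VSet n) (f g : Fin n → ℕ) → sumOn T (λ x → f x + g x) ≡ sumOn T f + sumOn T g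
sumOn-+ T f g = trans (sumℕ-cong pointwise) (sumℕ-+ (λ x → if T x then f x else 0) (λ x → if T x then g x else 0))
  where
  pointwise : ∀ x → (if T x then f x + g x else 0) ≡ (if T x then f x else 0) + (if T x then g x else 0)
  pointwise x with T x
  ... | true  = refl
  ... | false = refl

sumOn-mono : (T : VSet n) {f g : Fin n → ℕ} → (∀ x → T x ≡ true → f x ≤ g x) → sumOn T f ≤ sumOn T g
sumOn-mono T {f} {g} f≤g = sumℕ-mono pointwise
  where
  pointwise : ∀ x → (if T x then f x else 0) ≤ (if T x then g x else 0)
  pointwise x with T x in Tx
  ... | true  = f≤g x Tx
  ... | false = z≤n

sumOn≤sumℕ : (T : VSet n) (f : Fin n → ℕ) → sumOn T f ≤ sumℕ f
sumOn≤sumℕ T f = sumℕ-mono pointwise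
  where
  pointwise : ∀ x → (if T x then f x else 0) ≤ f x
  pointwise x with T x
  ... | true  = ≤-refl
  ... | false = z≤n

term≤sumOn : (T : VSet n) (f : Fin n → ℕ) → ∀ {x} → T x ≡ true → f x ≤ sumOn T f
term≤sumOn T f {x} Tx = ≤-trans (≤-reflexive (cong (λ b → if b then f x else 0) (≡-sym Tx)))
                                (term≤sumℕ (λ x → if T x then f x else 0) x)

sumOn-split : (T P : VSet n) (f : Fin n → ℕ) →
              sumOn T f ≡ sumOn (λ x → T x ∧ P x) f + sumOn (λ x → T x ∧ not (P x)) f
sumOn-split T P f = trans (sumℕ-cong pointwise)
  (sumℕ-+ (λ x → if T x ∧ P x then f x else 0) (λ x → if T x ∧ not (P x) then f x else 0))
  where
  pointwise : ∀ x → (if T x then f x else 0) ≡ (if T x ∧ P x then f x else 0) + (if T x ∧ not (P x) then f x else 0)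
  pointwise x with T x | P x
  ... | true  | true  = ≡-sym (+-identityʳ _)
  ... | true  | false = refl
  ... | false | _     = refl

sumOn≥const : (T : VSet n) {f : Fin n → ℕ} → ∀ c → (∀ x → T x ≡ true → c ≤ f x) → c * count T ≤ sumOn T f
sumOn≥const T c c≤f = ≤-trans (≤-reflexive (≡-sym (sumOn-const T c))) (sumOn-mono T c≤f)

sumOn≤const : (T : VSet n) {f : Fin n → ℕ} → ∀ c → (∀ x → T x ≡ true → f x ≤ c) → sumOn T f ≤ c * count T
sumOn≤const T c f≤c = ≤-trans (sumOn-mono T f≤c) (≤-reflexive (sumOn-const T c))

δ : Fin n → Fin n → ℕ
δ i j = ⟦ does (i Fin.≟ j) ⟧

δ-refl : (i : Fin n) → δ i i ≡ 1
δ-refl zero    = refl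
δ-refl (suc i) = δ-refl i

δ-≢ : {i j : Fin n} → i ≢ j → δ i j ≡ 0
δ-≢ {i = i} {j} i≢j with i Fin.≟ j
... | yes i≡j = ⊥-elim (i≢j i≡j)
... | no  _   = refl

sumℕ-δ : (i : Fin n) → sumℕ (δ i) ≡ 1
sumℕ-δ {suc n} zero    = cong suc (sumℕ-0 n)
sumℕ-δ         (suc i) = sumℕ-δ i

argmin : (T : VSet n) (f : Fin n → ℕ) → ∃ (λ x → T x ≡ true) →
         ∃ λ x → T x ≡ true × (∀ y → T y ≡ true → f x ≤ f y)
argmin T f (x , Tx) = descend x Tx (<-wellFounded (f x))
  where
  descend : ∀ x → T x ≡ true → Acc _<_ (f x) → ∃ λ x → T x ≡ true × (∀ y → T y ≡ true → f x ≤ f y)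
  descend x Tx (acc rs) with any? (λ y → (T y Bool.≟ true) ×-dec (f y <? f x))
  ... | yes (y , Ty , fy<fx) = descend y Ty (rs fy<fx)
  ... | no  ∄y               = x , Tx , λ y Ty → ≮⇒≥ (λ fy<fx → ∄y (y , Ty , fy<fx))

-- Bipartite degree-constrained subgraphs

Matrix : ℕ → Set
Matrix n = Fin n → Fin n → Bool

_⊑_ : Matrix n → Matrix n → Set
M ⊑ B = ∀ x y → M x y ≡ true → B x y ≡ true

row col : Matrix n → Fin n → ℕ
row M x = count (M x)
col M y = count (λ x → M x y)

-- Stated on numerical entries so that row and column sums follow by linearity. Removing a unit is
-- expressed by exchanging the two matrices, which avoids subtraction.
record AddsUnit (M : Matrix n) (x y : Fin n) (M′ : Matrix n) : Set where
  constructor addsUnit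
  field entry : ∀ z w → ⟦ M′ z w ⟧ ≡ ⟦ M z w ⟧ + δ x z * δ y w

row-AddsUnit : {M M′ : Matrix n} {x y : Fin n} → AddsUnit M x y M′ → ∀ z → row M′ z ≡ row M z + δ x z
row-AddsUnit {M = M} {M′} {x} {y} (addsUnit adds) z = trans (sumℕ-cong (adds z)) (trans (sumℕ-+ (λ w → ⟦ M z w ⟧) (λ w → δ x z * δ y w)) (cong (_+_ (row M z))
  (trans (sumℕ-*ˡ (δ x z) (δ y)) (trans (cong (δ x z *_) (sumℕ-δ y)) (*-identityʳ _)))))

col-AddsUnit : {M M′ : Matrix n} {x y : Fin n} → AddsUnit M x y M′ → ∀ w → col M′ w ≡ col M w + δ y w
col-AddsUnit {M = M} {M′} {x} {y} (addsUnit adds) w =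
  row-AddsUnit {M = λ y x → M x y} {λ y x → M′ x y} {y} {x}
    (addsUnit (λ w z → trans (adds z w) (cong (_+_ ⟦ M z w ⟧) (*-comm (δ x z) (δ y w))))) w

set : Bool → Fin n → Fin n → Matrix n → Matrix n
set b x y M z w = if does (x Fin.≟ z) ∧ does (y Fin.≟ w) then b else M z w

set-true-adds : (M : Matrix n) → ∀ {x y} → M x y ≡ false → AddsUnit M x y (set true x y M)
set-true-adds M {x} {y} Mxy = addsUnit entry
  where
  entry : ∀ z w → ⟦ set true x y M z w ⟧ ≡ ⟦ M z w ⟧ + δ x z * δ y w
  entry z w with x Fin.≟ z | y Fin.≟ w
  ... | yes refl | yes refl rewrite Mxy = refl
  ... | yes refl | no  _    = ≡-sym (+-identityʳ _)
  ... | no  _    | _        = ≡-sym (+-identityʳ _)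

set-false-adds : (M : Matrix n) → ∀ {x y} → M x y ≡ true → AddsUnit (set false x y M) x y M
set-false-adds M {x} {y} Mxy = addsUnit entry
  where
  entry : ∀ z w → ⟦ M z w ⟧ ≡ ⟦ set false x y M z w ⟧ + δ x z * δ y w
  entry z w with x Fin.≟ z | y Fin.≟ w
  ... | yes refl | yes refl rewrite Mxy = refl
  ... | yes refl | no  _    = ≡-sym (+-identityʳ _)
  ... | no  _    | _        = ≡-sym (+-identityʳ _)

set-true-⊑ : {M B : Matrix n} → ∀ x y → M ⊑ B → B x y ≡ true → set true x y M ⊑ B
set-true-⊑ x y M⊑B Bxy z w with x Fin.≟ z | y Fin.≟ w
... | yes refl | yes refl = λ _ → Bxy
... | yes refl | no  _    = M⊑B z w
... | no  _    | _        = M⊑B z w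

set-false-⊑ : {M B : Matrix n} → ∀ x y → M ⊑ B → set false x y M ⊑ B
set-false-⊑ x y M⊑B z w with x Fin.≟ z | y Fin.≟ w
... | yes refl | yes refl = λ ()
... | yes refl | no  _    = M⊑B z w
... | no  _    | _        = M⊑B z w

set-elsewhere : ∀ b (M : Matrix n) x y {z w} → x ≢ z ⊎ y ≢ w → set b x y M z w ≡ M z w
set-elsewhere b M x y {z} {w} ≢ with x Fin.≟ z | y Fin.≟ w | ≢
... | yes refl | yes refl | inj₁ x≢z = ⊥-elim (x≢z refl)
... | yes refl | yes refl | inj₂ y≢w = ⊥-elim (y≢w refl)
... | yes refl | no  _    | _ = refl
... | no  _    | _        | _ = refl

insert : Fin n → VSet n → VSet n
insert x T z = does (x Fin.≟ z) ∨ T z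

insert-self : (x : Fin n) (T : VSet n) → insert x T x ≡ true
insert-self x T with x Fin.≟ x
... | yes _   = refl
... | no  x≢x = ⊥-elim (x≢x refl)

insert-⊇ : (x : Fin n) (T : VSet n) → ∀ z → T z ≡ true → insert x T z ≡ true
insert-⊇ x T z Tz with x Fin.≟ z
... | yes _ = refl
... | no  _ = Tz

insert-cases : (x : Fin n) (T : VSet n) → ∀ z → insert x T z ≡ true → x ≡ z ⊎ T z ≡ true
insert-cases x T z e with x Fin.≟ z
... | yes x≡z = inj₁ x≡z
... | no  _   = inj₂ e

insert-∉ : (x : Fin n) (T : VSet n) → ∀ z → insert x T z ≡ false → x ≢ z × T z ≡ false
insert-∉ x T z e with x Fin.≟ z | e
... | yes _   | ()
... | no  x≢z | e′ = x≢z , e′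

unvisited : VSet n → ℕ
unvisited T = count (λ z → not (T z))

unvisited-insert : (x : Fin n) (T : VSet n) → T x ≡ false → unvisited (insert x T) < unvisited T
unvisited-insert x T Tx = sumℕ-mono-< le x lt
  where
  le : ∀ z → ⟦ not (insert x T z) ⟧ ≤ ⟦ not (T z) ⟧
  le z with x Fin.≟ z
  ... | yes _ = z≤n
  ... | no  _ = ≤-refl
  lt : ⟦ not (insert x T x) ⟧ < ⟦ not (T x) ⟧
  lt rewrite insert-self x T | Tx = s≤s z≤n

-- Cuts and alternating paths

out : Matrix n → VSet n → Fin n → ℕ
out B S x = count (λ y → not (S y) ∧ B x y)

-- The Hall-type condition for the bipartite graph of rows and columns: a column in `S` can serve
-- the rows in `T` with at most `hi` units, the other columns with at most one unit per entry of
-- `B`. As `T` consists of rows and `S` of columns, the two may overlap as vertex sets.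
NoDeficientCut : Matrix n → (lo hi : Fin n → ℕ) → Set
NoDeficientCut {n} B lo hi = (T S : VSet n) → sumOn T lo ≤ sumOn S hi + sumOn T (out B S)

module Augment (B : Matrix n) (lo hi : Fin n → ℕ) (lo≤hi : ∀ x → lo x ≤ hi x) (noCut : NoDeficientCut B lo hi)
               (M : Matrix n) (M⊑B : M ⊑ B) (row≤hi : ∀ x → row M x ≤ hi x) (col≤hi : ∀ y → col M y ≤ hi y)
               (x₀ : Fin n) (deficient : row M x₀ < lo x₀) where

  -- Gaps use truncated subtraction, so a surplus in one line cannot offset a deficit in another.
  -- The last three fields make the total gap drop strictly.
  record Augmented : Set where
    field
      M′        : Matrix n
      M′⊑B      : M′ ⊑ B
      row′≤hi   : ∀ x → row M′ x ≤ hi x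
      col′≤hi   : ∀ y → col M′ y ≤ hi y
      rowGap    : ∀ x → lo x ∸ row M′ x ≤ lo x ∸ row M x
      rowGap-x₀ : lo x₀ ∸ row M′ x₀ < lo x₀ ∸ row M x₀
      colGap    : ∀ y → lo y ∸ col M′ y ≤ lo y ∸ col M y

  -- Instead of the alternating path to a visited node, the search stores the
  -- matrix obtained from M by switching that path.  It differs from M only
  -- inside T × S, so an entry leading to an unvisited node can still be switched.
  record Switched (T S : VSet n) (loss gain : Fin n → ℕ) : Set where
    field
      M′      : Matrix n
      M′⊑B    : M′ ⊑ B
      row′    : ∀ z → row M′ z + loss z ≡ row M z + δ x₀ z
      col′    : ∀ w → col M′ w ≡ col M w + gain w
      outside : ∀ z w → T z ≡ false ⊎ S w ≡ false → M′ z w ≡ M z w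

  -- Switching a path from `x₀` to a row moves one unit from that row to `x₀` and keeps all column
  -- sums; a path to a column adds one unit to `x₀` and to that column.
  RowSwitched ColSwitched : VSet n → VSet n → Fin n → Set
  RowSwitched T S x = Switched T S (δ x) (λ _ → 0)
  ColSwitched T S y = Switched T S (λ _ → 0) (δ y)

  -- The bounds record that the search has not yet met a place to stop: no visited row has a unit to
  -- spare above `lo`, and every visited column is saturated.
  record State (T S : VSet n) : Set where
    field
      x₀∈T   : T x₀ ≡ true
      rows   : ∀ x → T x ≡ true → RowSwitched T S x
      cols   : ∀ y → S y ≡ true → ColSwitched T S y
      row≤lo : ∀ x → T x ≡ true → row M x ≤ lo x
      hi≤col : ∀ y → S y ≡ true → hi y ≤ col M y

  true≢false : true ≢ false
  true≢false ()

  anti : {T T′ : VSet n} → (∀ z → T z ≡ true → T′ z ≡ true) → ∀ z → T′ z ≡ false → T z ≡ false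
  anti {T} T⊆T′ z T′z with T z in Tz
  ... | false = refl
  ... | true  = ⊥-elim (true≢false (trans (≡-sym (T⊆T′ z Tz)) T′z))

  weaken : ∀ {T S T′ S′ loss gain} → (∀ z → T z ≡ true → T′ z ≡ true) → (∀ z → S z ≡ true → S′ z ≡ true) →
           Switched T S loss gain → Switched T′ S′ loss gain
  weaken {T} {S} {T′} {S′} T⊆T′ S⊆S′ sw = record
    { M′ = M′ ; M′⊑B = M′⊑B ; row′ = row′ ; col′ = col′ ; outside = λ z w → λ where
        (inj₁ e) → outside z w (inj₁ (anti {T} {T′} T⊆T′ z e))
        (inj₂ e) → outside z w (inj₂ (anti {S} {S′} S⊆S′ w e)) }
    where open Switched sw

  -- A row above its lower bound can give up a unit without opening a gap. It differs from `x₀`,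
  -- which is below its own bound.
  augment-at-row : ∀ {T S} x → lo x < row M x → RowSwitched T S x → Augmented
  augment-at-row x lo<row sw = record
    { M′ = M′ ; M′⊑B = M′⊑B ; row′≤hi = row′≤hi
    ; col′≤hi = λ y → subst (_≤ hi y) (≡-sym (col≡ y)) (col≤hi y)
    ; rowGap = rowGap ; rowGap-x₀ = rowGap-x₀
    ; colGap = λ y → ≤-reflexive (cong (lo y ∸_) (col≡ y)) }
    where
    open Switched sw
    col≡ : ∀ y → col M′ y ≡ col M y
    col≡ y = trans (col′ y) (+-identityʳ _)
    x≢x₀ : x ≢ x₀
    x≢x₀ refl = <-asym lo<row deficient
    row-x₀ : row M′ x₀ ≡ suc (row M x₀)
    row-x₀ with row′ x₀
    ... | e rewrite δ-≢ x≢x₀ | δ-refl x₀ | +-identityʳ (row M′ x₀) | +-comm (row M x₀) 1 = e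
    row-z : ∀ z → z ≢ x₀ → row M′ z + δ x z ≡ row M z
    row-z z z≢x₀ with row′ z
    ... | e rewrite δ-≢ {i = x₀} {z} (λ e → z≢x₀ (≡-sym e)) | +-identityʳ (row M z) = e
    rowGap-x₀ : lo x₀ ∸ row M′ x₀ < lo x₀ ∸ row M x₀
    rowGap-x₀ rewrite row-x₀ = ∸-monoʳ-< ≤-refl deficient
    row′≤hi : ∀ z → row M′ z ≤ hi z
    row′≤hi z with z Fin.≟ x₀
    ... | yes refl = subst (_≤ hi x₀) (≡-sym row-x₀) (≤-trans deficient (lo≤hi x₀))
    ... | no  z≢x₀ = ≤-trans (m+n≤o⇒m≤o _ (≤-reflexive (row-z z z≢x₀))) (row≤hi z)
    rowGap : ∀ z → lo z ∸ row M′ z ≤ lo z ∸ row M z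
    rowGap z with z Fin.≟ x₀
    ... | yes refl = <⇒≤ rowGap-x₀
    ... | no  z≢x₀ with x Fin.≟ z
    ...   | yes refl = ≤-trans (≤-reflexive (m≤n⇒m∸n≡0 lo≤row′)) z≤n
      where
      lo≤row′ : lo x ≤ row M′ x
      lo≤row′ with row-z x z≢x₀
      ... | e rewrite δ-refl x | +-comm (row M′ x) 1 = s≤s⁻¹ (subst (lo x <_) (≡-sym e) lo<row)
    ...   | no x≢z with row-z z z≢x₀
    ...     | e rewrite δ-≢ x≢z | +-identityʳ (row M′ z) = ≤-reflexive (cong (lo z ∸_) e)

  -- An unsaturated column can absorb the extra unit, so the path may end there; the only row sum
  -- that changes is that of `x₀`.
  augment-at-col : ∀ {T S} y → col M y < hi y → ColSwitched T S y → Augmented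
  augment-at-col y col<hi sw = record
    { M′ = M′ ; M′⊑B = M′⊑B ; row′≤hi = row′≤hi ; col′≤hi = col′≤hi
    ; rowGap = λ z → ∸-monoʳ-≤ (lo z) (subst (row M z ≤_) (≡-sym (row≡ z)) (m≤m+n _ _))
    ; rowGap-x₀ = rowGap-x₀
    ; colGap = λ w → ∸-monoʳ-≤ (lo w) (subst (col M w ≤_) (≡-sym (col′ w)) (m≤m+n _ _)) }
    where
    open Switched sw
    row≡ : ∀ z → row M′ z ≡ row M z + δ x₀ z
    row≡ z = trans (≡-sym (+-identityʳ _)) (row′ z)
    row-x₀ : row M′ x₀ ≡ suc (row M x₀)
    row-x₀ = trans (row≡ x₀) (trans (cong (_+_ (row M x₀)) (δ-refl x₀)) (+-comm _ 1))
    rowGap-x₀ : lo x₀ ∸ row M′ x₀ < lo x₀ ∸ row M x₀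
    rowGap-x₀ rewrite row-x₀ = ∸-monoʳ-< ≤-refl deficient
    row′≤hi : ∀ z → row M′ z ≤ hi z
    row′≤hi z with x₀ Fin.≟ z | row≡ z
    ... | yes refl | _ = subst (_≤ hi x₀) (≡-sym row-x₀) (≤-trans deficient (lo≤hi x₀))
    ... | no  _    | e = subst (_≤ hi z) (≡-sym (trans e (+-identityʳ _))) (row≤hi z)
    col′≤hi : ∀ w → col M′ w ≤ hi w
    col′≤hi w with y Fin.≟ w | col′ w
    ... | yes refl | e = subst (_≤ hi y) (≡-sym (trans e (+-comm _ 1))) col<hi
    ... | no  _    | e = subst (_≤ hi w) (≡-sym (trans e (+-identityʳ _))) (col≤hi w)

  extend-col : ∀ {T S} x y → T x ≡ true → S y ≡ false → B x y ≡ true → M x y ≡ false →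
               RowSwitched T S x → ColSwitched T (insert y S) y
  extend-col {T} {S} x y Tx Sy Bxy Mxy sw = record
    { M′ = set true x y M′ ; M′⊑B = set-true-⊑ x y M′⊑B Bxy
    ; row′ = λ z → trans (+-identityʳ _) (trans (row-AddsUnit adds z) (row′ z))
    ; col′ = λ w → trans (col-AddsUnit adds w) (cong (_+ δ y w) (trans (col′ w) (+-identityʳ _)))
    ; outside = λ z w → λ where
        (inj₁ Tz) → trans (set-elsewhere true M′ x y (inj₁ (λ { refl → true≢false (trans (≡-sym Tx) Tz) })))
                          (outside z w (inj₁ Tz))
        (inj₂ Sw) → let y≢w , Sw′ = insert-∉ y S w Sw in
                    trans (set-elsewhere true M′ x y (inj₂ y≢w)) (outside z w (inj₂ Sw′)) }
    where
    open Switched sw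
    adds : AddsUnit M′ x y (set true x y M′)
    adds = set-true-adds M′ (trans (outside x y (inj₂ Sy)) Mxy)

  -- Removing a used entry cancels the gain of column `y` and shifts the loss to row `x`. Since `x`
  -- was unvisited, the entry still has its value from `M`.
  extend-row : ∀ {T S} x y → T x ≡ false → S y ≡ true → M x y ≡ true →
               ColSwitched T S y → RowSwitched (insert x T) S x
  extend-row {T} {S} x y Tx Sy Mxy sw = record
    { M′ = set false x y M′ ; M′⊑B = set-false-⊑ x y M′⊑B
    ; row′ = λ z → trans (≡-sym (row-AddsUnit adds z)) (trans (≡-sym (+-identityʳ _)) (row′ z))
    ; col′ = λ w → +-cancelʳ-≡ (δ y w) _ _
               (trans (≡-sym (col-AddsUnit adds w)) (trans (col′ w) (cong (_+ δ y w) (≡-sym (+-identityʳ _)))))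
    ; outside = λ z w → λ where
        (inj₁ Tz) → let x≢z , Tz′ = insert-∉ x T z Tz in
                    trans (set-elsewhere false M′ x y (inj₁ x≢z)) (outside z w (inj₁ Tz′))
        (inj₂ Sw) → trans (set-elsewhere false M′ x y (inj₂ (λ { refl → true≢false (trans (≡-sym Sy) Sw) })))
                          (outside z w (inj₂ Sw)) }
    where
    open Switched sw
    adds : AddsUnit (set false x y M′) x y M′
    adds = set-false-adds M′ (trans (outside x y (inj₁ Tx)) Mxy)

  -- When nothing can be visited any more, M is full from T to the complement
  -- of S and empty from the complement of T to S, so (T, S) is a deficient cut.
  closed-absurd : ∀ {T S} → State T S →
                  (∀ x y → T x ≡ true → S y ≡ false → B x y ≡ true → M x y ≡ true) →
                  (∀ x y → S y ≡ true → M x y ≡ true → T x ≡ true) → ⊥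
  closed-absurd {T} {S} st full empty = <-irrefl refl (begin-strict
    sumOn T lo                            ≤⟨ noCut T S ⟩
    sumOn S hi + sumOn T (out B S)        ≤⟨ +-monoˡ-≤ _ (sumOn-mono S hi≤col) ⟩
    sumOn S (col M) + sumOn T (out B S)   ≤⟨ +-monoˡ-≤ _ cols≤ ⟩
    sumOn T inS + sumOn T (out B S)       ≡⟨ ≡-sym (sumOn-+ T inS (out B S)) ⟩
    sumOn T (λ x → inS x + out B S x)     ≤⟨ sumOn-mono T rows≤ ⟩
    sumOn T (row M)                       <⟨ sumℕ-mono-< pointwise x₀ pointwise-x₀ ⟩
    sumOn T lo                            ∎)
    where
    open ≤-Reasoning
    open State st
    inS : Fin n → ℕ
    inS x = sumℕ (λ y → if S y then ⟦ M x y ⟧ else 0)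
    cols≤ : sumOn S (col M) ≤ sumOn T inS
    cols≤ = begin
      sumOn S (col M)                                                     ≤⟨ sumℕ-mono into ⟩
      sumℕ (λ y → sumℕ (λ x → if T x then (if S y then ⟦ M x y ⟧ else 0) else 0)) ≡⟨ ≡-sym (sumℕ-swap (λ x y → if T x then (if S y then ⟦ M x y ⟧ else 0) else 0)) ⟩
      sumℕ (λ x → sumℕ (λ y → if T x then (if S y then ⟦ M x y ⟧ else 0) else 0)) ≤⟨ sumℕ-mono outof ⟩
      sumOn T inS                                                         ∎
      where
      into : ∀ y → (if S y then col M y else 0) ≤ sumℕ (λ x → if T x then (if S y then ⟦ M x y ⟧ else 0) else 0)
      into y with S y in Sy
      ... | false = z≤n
      ... | true  = sumℕ-mono term
        where
        term : ∀ x → ⟦ M x y ⟧ ≤ (if T x then ⟦ M x y ⟧ else 0)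
        term x with M x y in Mxy
        ... | false = z≤n
        ... | true rewrite empty x y Sy Mxy = ≤-refl
      outof : ∀ x → sumℕ (λ y → if T x then (if S y then ⟦ M x y ⟧ else 0) else 0) ≤ (if T x then inS x else 0)
      outof x with T x
      ... | true  = ≤-refl
      ... | false = ≤-reflexive (sumℕ-0 n)
    rows≤ : ∀ x → T x ≡ true → inS x + out B S x ≤ row M x
    rows≤ x Tx = ≤-trans (≤-reflexive (≡-sym (sumℕ-+ (λ y → if S y then ⟦ M x y ⟧ else 0) (λ y → ⟦ not (S y) ∧ B x y ⟧)))) (sumℕ-mono term)
      where
      term : ∀ y → (if S y then ⟦ M x y ⟧ else 0) + ⟦ not (S y) ∧ B x y ⟧ ≤ ⟦ M x y ⟧
      term y with S y in Sy
      ... | true = ≤-reflexive (+-identityʳ _)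
      ... | false with B x y in Bxy
      ...   | false = z≤n
      ...   | true rewrite full x y Tx Sy Bxy = ≤-refl
    pointwise : ∀ x → (if T x then row M x else 0) ≤ (if T x then lo x else 0)
    pointwise x with T x in Tx
    ... | true  = row≤lo x Tx
    ... | false = z≤n
    pointwise-x₀ : (if T x₀ then row M x₀ else 0) < (if T x₀ then lo x₀ else 0)
    pointwise-x₀ rewrite x₀∈T = deficient

  search : ∀ {T S} → State T S → Acc _<_ (unvisited T + unvisited S) → Augmented
  search {T} {S} st (acc rs)
    with any? (λ x → any? (λ y → (T x Bool.≟ true) ×-dec (S y Bool.≟ false) ×-dec (B x y Bool.≟ true) ×-dec (M x y Bool.≟ false)))
  ... | yes (x , y , Tx , Sy , Bxy , Mxy) = visit (col M y <? hi y)
    where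
    open State st
    sw : ColSwitched T (insert y S) y
    sw = extend-col x y Tx Sy Bxy Mxy (rows x Tx)
    S⊆ : ∀ z → S z ≡ true → insert y S z ≡ true
    S⊆ = insert-⊇ y S
    visit : Dec (col M y < hi y) → Augmented
    visit (yes col<hi) = augment-at-col y col<hi sw
    visit (no  col≮hi) = search st′ (rs (+-monoʳ-< (unvisited T) (unvisited-insert y S Sy)))
      where
      cols′ : ∀ w → insert y S w ≡ true → ColSwitched T (insert y S) w × hi w ≤ col M w
      cols′ w e with insert-cases y S w e
      ... | inj₁ refl = sw , ≮⇒≥ col≮hi
      ... | inj₂ Sw   = weaken (λ _ Tz → Tz) S⊆ (cols w Sw) , hi≤col w Sw
      st′ : State T (insert y S)
      st′ = record
        { x₀∈T = x₀∈T ; rows = λ z Tz → weaken (λ _ Tz → Tz) S⊆ (rows z Tz)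
        ; cols = λ w e → proj₁ (cols′ w e) ; row≤lo = row≤lo ; hi≤col = λ w e → proj₂ (cols′ w e) }
  ... | no ∄col
    with any? (λ x → any? (λ y → (T x Bool.≟ false) ×-dec (S y Bool.≟ true) ×-dec (M x y Bool.≟ true)))
  ...   | yes (x , y , Tx , Sy , Mxy) = visit (lo x <? row M x)
    where
    open State st
    sw : RowSwitched (insert x T) S x
    sw = extend-row x y Tx Sy Mxy (cols y Sy)
    T⊆ : ∀ z → T z ≡ true → insert x T z ≡ true
    T⊆ = insert-⊇ x T
    visit : Dec (lo x < row M x) → Augmented
    visit (yes lo<row) = augment-at-row x lo<row sw
    visit (no  lo≮row) = search st′ (rs (+-monoˡ-< (unvisited S) (unvisited-insert x T Tx)))
      where
      rows′ : ∀ z → insert x T z ≡ true → RowSwitched (insert x T) S z × row M z ≤ lo z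
      rows′ z e with insert-cases x T z e
      ... | inj₁ refl = sw , ≮⇒≥ lo≮row
      ... | inj₂ Tz   = weaken T⊆ (λ _ Sw → Sw) (rows z Tz) , row≤lo z Tz
      st′ : State (insert x T) S
      st′ = record
        { x₀∈T = T⊆ x₀ x₀∈T ; rows = λ z e → proj₁ (rows′ z e)
        ; cols = λ w Sw → weaken T⊆ (λ _ Sw → Sw) (cols w Sw) ; row≤lo = λ z e → proj₂ (rows′ z e) ; hi≤col = hi≤col }
  ...   | no ∄row = ⊥-elim (closed-absurd st
            (λ x y Tx Sy Bxy → Bool.¬-not (λ Mxy → ∄col (x , y , Tx , Sy , Bxy , Mxy)))
            (λ x y Sy Mxy → Bool.¬-not (λ Tx → ∄row (x , y , Tx , Sy , Mxy))))

  augment : Augmented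
  augment = search {insert x₀ (λ _ → false)} {λ _ → false} st (<-wellFounded _)
    where
    start : ∀ x → insert x₀ (λ _ → false) x ≡ true → x₀ ≡ x
    start x e with insert-cases x₀ (λ _ → false) x e
    ... | inj₁ x₀≡x = x₀≡x
    ... | inj₂ ()
    st : State (insert x₀ (λ _ → false)) (λ _ → false)
    st = record
      { x₀∈T = insert-self x₀ _
      ; rows = λ x e → subst (RowSwitched _ _) (start x e) (record
          { M′ = M ; M′⊑B = M⊑B ; row′ = λ _ → refl ; col′ = λ _ → ≡-sym (+-identityʳ _) ; outside = λ _ _ _ → refl })
      ; cols = λ _ ()
      ; row≤lo = λ x e → subst (λ x → row M x ≤ lo x) (start x e) (<⇒≤ deficient)
      ; hi≤col = λ _ () }

record DegreeConstrained (B : Matrix n) (lo hi : Fin n → ℕ) : Set where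
  field
    M      : Matrix n
    M⊑B    : M ⊑ B
    lo≤row : ∀ x → lo x ≤ row M x
    row≤hi : ∀ x → row M x ≤ hi x
    lo≤col : ∀ y → lo y ≤ col M y
    col≤hi : ∀ y → col M y ≤ hi y

degreeConstrained : (B : Matrix n) → (∀ x y → B x y ≡ B y x) → (lo hi : Fin n → ℕ) → (∀ x → lo x ≤ hi x) →
                    NoDeficientCut B lo hi → DegreeConstrained B lo hi
degreeConstrained {n} B B-sym lo hi lo≤hi noCut =
  improve (λ _ _ → false) (λ _ _ ()) zero≤hi zero≤hi (<-wellFounded _)
  where
  zero≤hi : ∀ x → count {n} (λ _ → false) ≤ hi x
  zero≤hi x = subst (_≤ hi x) (≡-sym (sumℕ-0 n)) z≤n
  gap : Matrix n → ℕ
  gap M = sumℕ (λ x → lo x ∸ row M x) + sumℕ (λ y → lo y ∸ col M y)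
  improve : (M : Matrix n) → M ⊑ B → (∀ x → row M x ≤ hi x) → (∀ y → col M y ≤ hi y) → Acc _<_ (gap M) →
            DegreeConstrained B lo hi
  improve M M⊑B row≤hi col≤hi (acc rs) with any? (λ x → row M x <? lo x)
  ... | yes (x , row<lo) = improve M′ M′⊑B row′≤hi col′≤hi
          (rs (+-mono-<-≤ (sumℕ-mono-< rowGap x rowGap-x₀) (sumℕ-mono colGap)))
    where open Augment.Augmented (Augment.augment B lo hi lo≤hi noCut M M⊑B row≤hi col≤hi x row<lo)
  ... | no ∄row with any? (λ y → col M y <? lo y)
  -- A deficient column is a deficient row of the transpose, to which the same cut condition applies
  -- because `B` is symmetric.
  ...   | yes (y , col<lo) = improve (λ x y → M′ y x) (λ x y M′yx → trans (B-sym x y) (M′⊑B y x M′yx)) col′≤hi row′≤hi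
          (rs (+-mono-≤-< (sumℕ-mono colGap) (sumℕ-mono-< rowGap y rowGap-x₀)))
    where open Augment.Augmented (Augment.augment B lo hi lo≤hi noCut (λ y x → M x y)
                                    (λ y x Mxy → trans (B-sym y x) (M⊑B x y Mxy)) col≤hi row≤hi y col<lo)
  ...   | no ∄col = record
    { M = M ; M⊑B = M⊑B ; row≤hi = row≤hi ; col≤hi = col≤hi
    ; lo≤row = λ x → ≮⇒≥ (λ row<lo → ∄row (x , row<lo)) ; lo≤col = λ y → ≮⇒≥ (λ col<lo → ∄col (y , col<lo)) }

-- An edge from T ∖ S to S ∩ T is, read backwards, an edge from S ∩ T to the
-- complement of S, so uncrossing loses no more than it gains.
out-uncross : (B : Matrix n) → (∀ x y → B x y ≡ B y x) → (T S : VSet n) →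
              sumOn (λ x → T x ∧ not (S x)) (out B (λ y → S y ∧ not (T y))) ≤ sumOn T (out B S)
out-uncross {n} B B-sym T S = +-cancelʳ-≤ (sum₂ R) _ _ (begin
  sumOn T₁ (out B S₁) + sum₂ R                ≡⟨ cong (_+ sum₂ R) (unfold T₁ S₁) ⟩
  sum₂ (cut T₁ S₁) + sum₂ R                   ≡⟨ ≡-sym (sum₂-+ (cut T₁ S₁) R) ⟩
  sum₂ (λ x y → cut T₁ S₁ x y + R x y)        ≤⟨ sumℕ-mono (λ x → sumℕ-mono (λ y → pointwise x y)) ⟩
  sum₂ (λ x y → cut T S x y + R y x)          ≡⟨ sum₂-+ (cut T S) (λ x y → R y x) ⟩
  sum₂ (cut T S) + sum₂ (λ x y → R y x)       ≡⟨ cong₂ _+_ (≡-sym (unfold T S)) (sumℕ-swap (λ x y → R y x)) ⟩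
  sumOn T (out B S) + sum₂ R                  ∎)
  where
  open ≤-Reasoning
  T₁ S₁ : VSet n
  T₁ x = T x ∧ not (S x)
  S₁ y = S y ∧ not (T y)
  sum₂ : (Fin n → Fin n → ℕ) → ℕ
  sum₂ F = sumℕ (λ x → sumℕ (F x))
  sum₂-+ : ∀ F F′ → sum₂ (λ x y → F x y + F′ x y) ≡ sum₂ F + sum₂ F′
  sum₂-+ F F′ = trans (sumℕ-cong (λ x → sumℕ-+ (F x) (F′ x))) (sumℕ-+ (λ x → sumℕ (F x)) (λ x → sumℕ (F′ x)))
  cut : VSet n → VSet n → Fin n → Fin n → ℕ
  cut T S x y = if T x then ⟦ not (S y) ∧ B x y ⟧ else 0
  -- `R` marks the arcs from `S ∩ T` to the complement of `S`. It is added on one side and its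
  -- transpose on the other: their totals agree, and the comparison then holds arc by arc.
  R : Fin n → Fin n → ℕ
  R x y = ⟦ T x ∧ S x ∧ not (S y) ∧ B x y ⟧
  unfold : ∀ T S → sumOn T (out B S) ≡ sum₂ (cut T S)
  unfold T S = sumℕ-cong row-of
    where
    row-of : ∀ x → (if T x then out B S x else 0) ≡ sumℕ (cut T S x)
    row-of x with T x
    ... | true  = refl
    ... | false = ≡-sym (sumℕ-0 n)
  cases : ∀ tx sx ty sy b →
          (if tx ∧ not sx then ⟦ not (sy ∧ not ty) ∧ b ⟧ else 0) + ⟦ tx ∧ sx ∧ not sy ∧ b ⟧
            ≤ (if tx then ⟦ not sy ∧ b ⟧ else 0) + ⟦ ty ∧ sy ∧ not sx ∧ b ⟧
  cases false _     _     _     _ = z≤n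
  cases true  true  _     _     _ = m≤m+n _ _
  cases true  false _     false b = +-monoʳ-≤ ⟦ b ⟧ z≤n
  cases true  false true  true  b = ≤-reflexive (+-identityʳ ⟦ b ⟧)
  cases true  false false true  _ = z≤n
  pointwise : ∀ x y → cut T₁ S₁ x y + R x y ≤ cut T S x y + R y x
  pointwise x y rewrite B-sym y x = cases (T x) (S x) (T y) (S y) (B x y)

-- Two changes never make a cut less deficient. Dropping `S ∩ T` from both sets is harmless because
-- `lo` is at most `hi` and by uncrossing. Then `T` may be replaced by all vertices outside `S` at
-- which `lo` exceeds `out`, which maximises the sum of `lo - out`.
noDeficientCut : (B : Matrix n) → (∀ x y → B x y ≡ B y x) → (lo hi : Fin n → ℕ) → (∀ x → lo x ≤ hi x) →
  ((T S : VSet n) → (∀ x → T x ≡ true → S x ≡ false × out B S x < lo x) →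
    sumOn T lo ≤ sumOn S hi + sumOn T (out B S)) →
  NoDeficientCut B lo hi
noDeficientCut {n} B B-sym lo hi lo≤hi disjoint T S = +-cancelˡ-≤ (sumOn S₁ hi) _ _ (begin
  sumOn S₁ hi + sumOn T lo                               ≡⟨ +-comm (sumOn S₁ hi) _ ⟩
  sumOn T lo + sumOn S₁ hi                               ≤⟨ uncrossed ⟩
  sumOn T₁ lo + sumOn S hi                               ≤⟨ +-monoˡ-≤ _ for-T₁ ⟩
  sumOn S₁ hi + sumOn T₁ (out B S₁) + sumOn S hi         ≤⟨ +-monoˡ-≤ _ (+-monoʳ-≤ (sumOn S₁ hi) (out-uncross B B-sym T S)) ⟩
  sumOn S₁ hi + sumOn T (out B S) + sumOn S hi           ≡⟨ regroup (sumOn S₁ hi) _ _ ⟩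
  sumOn S₁ hi + (sumOn S hi + sumOn T (out B S))         ∎)
  where
  open ≤-Reasoning
  regroup : ∀ a b c → a + b + c ≡ a + (c + b)
  regroup = solve-∀
  T₁ S₁ T₂ : VSet n
  T₁ x = T x ∧ not (S x)
  S₁ y = S y ∧ not (T y)
  T₂ x = not (S₁ x) ∧ (out B S₁ x <ᵇ lo x)
  T₂-spec : ∀ x → T₂ x ≡ true → S₁ x ≡ false × out B S₁ x < lo x
  T₂-spec x e with S₁ x | out B S₁ x <ᵇ lo x | <ᵇ-reflects-< (out B S₁ x) (lo x)
  T₂-spec x e  | false | true  | ofʸ lt = refl , lt
  T₂-spec x () | false | false | _
  T₂-spec x () | true  | _ | _
  uncrossed : sumOn T lo + sumOn S₁ hi ≤ sumOn T₁ lo + sumOn S hi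
  uncrossed = begin
    sumOn T lo + sumOn S₁ hi ≡⟨ ≡-sym (sumℕ-+ (λ x → if T x then lo x else 0) (λ x → if S₁ x then hi x else 0)) ⟩
    sumℕ (λ x → (if T x then lo x else 0) + (if S₁ x then hi x else 0)) ≤⟨ sumℕ-mono pointwise ⟩
    sumℕ (λ x → (if T₁ x then lo x else 0) + (if S x then hi x else 0))
      ≡⟨ sumℕ-+ (λ x → if T₁ x then lo x else 0) (λ x → if S x then hi x else 0) ⟩
    sumOn T₁ lo + sumOn S hi ∎
    where
    pointwise : ∀ x → (if T x then lo x else 0) + (if S₁ x then hi x else 0)
                        ≤ (if T₁ x then lo x else 0) + (if S x then hi x else 0)
    pointwise x with T x | S x
    ... | true  | true  = subst (_≤ hi x) (≡-sym (+-identityʳ _)) (lo≤hi x)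
    ... | true  | false = ≤-refl
    ... | false | true  = ≤-refl
    ... | false | false = ≤-refl
  exchange : sumOn T₁ lo + sumOn T₂ (out B S₁) ≤ sumOn T₁ (out B S₁) + sumOn T₂ lo
  exchange = begin
    sumOn T₁ lo + sumOn T₂ (out B S₁)
      ≡⟨ ≡-sym (sumℕ-+ (λ x → if T₁ x then lo x else 0) (λ x → if T₂ x then out B S₁ x else 0)) ⟩
    sumℕ (λ x → (if T₁ x then lo x else 0) + (if T₂ x then out B S₁ x else 0)) ≤⟨ sumℕ-mono pointwise ⟩
    sumℕ (λ x → (if T₁ x then out B S₁ x else 0) + (if T₂ x then lo x else 0))
      ≡⟨ sumℕ-+ (λ x → if T₁ x then out B S₁ x else 0) (λ x → if T₂ x then lo x else 0) ⟩
    sumOn T₁ (out B S₁) + sumOn T₂ lo ∎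
    where
    pointwise : ∀ x → (if T₁ x then lo x else 0) + (if T₂ x then out B S₁ x else 0)
                        ≤ (if T₁ x then out B S₁ x else 0) + (if T₂ x then lo x else 0)
    pointwise x with T x | S x | out B S₁ x <ᵇ lo x | <ᵇ-reflects-< (out B S₁ x) (lo x)
    ... | true  | true  | true  | ofʸ lt = <⇒≤ lt
    ... | true  | true  | false | _ = z≤n
    ... | true  | false | true  | ofʸ lt = ≤-reflexive (+-comm (lo x) _)
    ... | true  | false | false | ofⁿ ge = +-monoˡ-≤ 0 (≮⇒≥ ge)
    ... | false | true  | _ | _ = z≤n
    ... | false | false | true  | ofʸ lt = <⇒≤ lt
    ... | false | false | false | _ = z≤n
  for-T₁ : sumOn T₁ lo ≤ sumOn S₁ hi + sumOn T₁ (out B S₁)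
  for-T₁ = +-cancelʳ-≤ (sumOn T₂ (out B S₁)) _ _ (begin
    sumOn T₁ lo + sumOn T₂ (out B S₁)                                     ≤⟨ exchange ⟩
    sumOn T₁ (out B S₁) + sumOn T₂ lo                                     ≤⟨ +-monoʳ-≤ (sumOn T₁ (out B S₁)) (disjoint T₂ S₁ T₂-spec) ⟩
    sumOn T₁ (out B S₁) + (sumOn S₁ hi + sumOn T₂ (out B S₁))             ≡⟨ regroup′ (sumOn T₁ (out B S₁)) (sumOn S₁ hi) _ ⟩
    sumOn S₁ hi + sumOn T₁ (out B S₁) + sumOn T₂ (out B S₁)               ∎)
    where
    regroup′ : ∀ a b c → a + (b + c) ≡ b + a + c
    regroup′ = solve-∀

-- Fractional factors from 0/1 matrices

half : ℕ → ℚ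
half k = + k ℚ./ 2

half-+ : ∀ j k → half (j + k) ≡ half j ℚ.+ half k
half-+ j k = ℚ.toℚᵘ-injective (begin
  ℚ.toℚᵘ (half (j + k))                      ≈⟨ ℚ.toℚᵘ-fromℚᵘ (mkℚᵘ (+ (j + k)) 1) ⟩
  -- Denominators are stored minus one; the unnormalised sum of two halves has denominator 4.
  mkℚᵘ (+ (j + k)) 1                         ≈⟨ *≡* common-denominator ⟩
  mkℚᵘ (+ j) 1 ℚᵘ.+ mkℚᵘ (+ k) 1             ≈⟨ ℚᵘ.+-cong (ℚᵘ.≃-sym (ℚ.toℚᵘ-fromℚᵘ (mkℚᵘ (+ j) 1)))
                                                         (ℚᵘ.≃-sym (ℚ.toℚᵘ-fromℚᵘ (mkℚᵘ (+ k) 1))) ⟩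
  ℚ.toℚᵘ (half j) ℚᵘ.+ ℚ.toℚᵘ (half k)       ≈⟨ ℚᵘ.≃-sym (ℚ.toℚᵘ-homo-+ (half j) (half k)) ⟩
  ℚ.toℚᵘ (half j ℚ.+ half k)                 ∎)
  where
  open ℚᵘ.≃-Reasoning
  common-denominator : + (j + k) ℤ.* + 4 ≡ (+ j ℤ.* + 2 ℤ.+ + k ℤ.* + 2) ℤ.* + 2
  common-denominator = trans (≡-sym (ℤ.pos-* (j + k) 4)) (trans (cong +_ (double j k)) (trans (ℤ.pos-* (j * 2 + k * 2) 2)
    (cong (ℤ._* + 2) (cong₂ ℤ._+_ (ℤ.pos-* j 2) (ℤ.pos-* k 2)))))
    where
    double : ∀ j k → (j + k) * 4 ≡ (j * 2 + k * 2) * 2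
    double = solve-∀

half-mono : ∀ {j k} → j ≤ k → half j ℚ.≤ half k
half-mono {j} {k} j≤k = ℚ.toℚᵘ-cancel-≤ (ℚᵘ.≤-respˡ-≃ (ℚᵘ.≃-sym (ℚ.toℚᵘ-fromℚᵘ (mkℚᵘ (+ j) 1)))
  (ℚᵘ.≤-respʳ-≃ (ℚᵘ.≃-sym (ℚ.toℚᵘ-fromℚᵘ (mkℚᵘ (+ k) 1))) (*≤* (ℤ.*-monoʳ-≤-nonNeg (+ 2) (ℤ.+≤+ j≤k)))))

half-double : ∀ k → half (k + k) ≡ + k ℚ./ 1
half-double k = ℚ.toℚᵘ-injective (ℚᵘ.≃-trans (ℚ.toℚᵘ-fromℚᵘ (mkℚᵘ (+ (k + k)) 1)) (ℚᵘ.≃-trans (*≡* doubled)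
  (ℚᵘ.≃-sym (ℚ.toℚᵘ-fromℚᵘ (mkℚᵘ (+ k) 0)))))
  where
  double : ∀ k → (k + k) * 1 ≡ k * 2
  double = solve-∀
  doubled : + (k + k) ℤ.* + 1 ≡ + k ℤ.* + 2
  doubled = trans (≡-sym (ℤ.pos-* (k + k) 1)) (trans (cong +_ (double k)) (ℤ.pos-* k 2))

sumℚ-half : (F : Fin n → ℚ) (k : Fin n → ℕ) → (∀ i → F i ≡ half (k i)) → sumℚ F ≡ half (sumℕ k)
sumℚ-half {zero}  F k F≡ = refl
sumℚ-half {suc n} F k F≡ =
  trans (cong₂ ℚ._+_ (F≡ zero) (sumℚ-half (λ i → F (suc i)) (λ i → k (suc i)) (λ i → F≡ (suc i))))
        (≡-sym (half-+ (k zero) (sumℕ (λ i → k (suc i)))))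

-- The sum of `h` at a vertex is half of its row sum plus its column sum in `M`, and both lie
-- between `lo` and `hi`. On `I` nothing links `g` to `lo`, so `lo` may be set to zero there.
symmetrised-factor : (G : Graph n) (I : VSet n) (H : ESet n) → (∀ u v → adjDel G I H u v ≡ adjDel G I H v u) →
  (lo hi : Fin n → ℕ) (g f : Fin n → ℤ) → (∀ x → I x ≡ false → g x ≡ + lo x) → (∀ x → f x ≡ + hi x) →
  DegreeConstrained (adjDel G I H) lo hi → HasFractionalFactorDel G I H g f
symmetrised-factor {n} G I H B-sym lo hi g f g≡ f≡ dc =
    h
  , (λ u v _ → cong half (+-comm ⟦ M u v ⟧ ⟦ M v u ⟧))
  , (λ u v _ → half-mono {0} {⟦ M u v ⟧ + ⟦ M v u ⟧} z≤n , half-mono {⟦ M u v ⟧ + ⟦ M v u ⟧} {2} (+-mono-≤ (⟦⟧≤1 (M u v)) (⟦⟧≤1 (M v u))))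
  , λ x Ix → bounds x Ix
  where
  open DegreeConstrained dc
  ⟦⟧≤1 : ∀ b → ⟦ b ⟧ ≤ 1
  ⟦⟧≤1 true  = ≤-refl
  ⟦⟧≤1 false = z≤n
  h : Fin n → Fin n → ℚ
  h u v = half (⟦ M u v ⟧ + ⟦ M v u ⟧)
  ∉M : ∀ x v → adjDel G I H x v ≡ false → M x v ≡ false
  ∉M x v Bxv with M x v in Mxv
  ... | false = refl
  ... | true  = trans (≡-sym (M⊑B x v Mxv)) Bxv
  term : ∀ x v → (if adjDel G I H x v then h x v else 0ℚ) ≡ half (⟦ M x v ⟧ + ⟦ M v x ⟧)
  term x v with adjDel G I H x v in Bxv
  ... | true  = refl
  ... | false rewrite ∉M x v Bxv | ∉M v x (trans (B-sym v x) Bxv) = refl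
  s≡ : ∀ x → sumℚ (λ v → if adjDel G I H x v then h x v else 0ℚ) ≡ half (row M x + col M x)
  s≡ x = trans (sumℚ-half (λ v → if adjDel G I H x v then h x v else 0ℚ) (λ v → ⟦ M x v ⟧ + ⟦ M v x ⟧) (term x))
               (cong half (sumℕ-+ (λ v → ⟦ M x v ⟧) (λ v → ⟦ M v x ⟧)))
  bounds : ∀ x → I x ≡ false →
           ((g x ℚ./ 1) ℚ.≤ sumℚ (λ v → if adjDel G I H x v then h x v else 0ℚ)) ×
           (sumℚ (λ v → if adjDel G I H x v then h x v else 0ℚ) ℚ.≤ (f x ℚ./ 1))
  bounds x Ix rewrite s≡ x | g≡ x Ix | f≡ x | ≡-sym (half-double (lo x)) | ≡-sym (half-double (hi x)) =
    half-mono (+-mono-≤ (lo≤row x) (lo≤col x)) , half-mono (+-mono-≤ (row≤hi x) (col≤hi x))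

-- Numerical contradictions

infixr 5 _⊕_
_⊕_ : ∀ {a b c d} → a ≤ b → c ≤ d → a + c ≤ b + d
_⊕_ = +-mono-≤

-- Abstract because ⊥ has η: conversion checking would evaluate the proofs.
abstract
  exceeds : ∀ {L R} → L ≤ R → ∀ z → L ≢ R + suc z
  exceeds L≤R z refl = m+1+n≰m _ L≤R

-- Each contradiction is certified by a polynomial identity: the left sides of suitably weighted
-- inequalities add up to their right sides plus a successor. Bounds such as `2 ≤ p` are first
-- solved, as in `p = 2 + p′`, so that no subtraction occurs.
surplus-identity₁ : ∀ p′ r b m s h e →
  (2 + p′) * s + 1 + h + (b * (suc h + r) + m * (2 + p′) + ((2 + p′) * e + (2 + p′) * (suc h + r)))
    ≡ suc h + r + ((s + (h + e)) * (2 + p′) + ((2 + p′) * m + b * (suc h + r))) + suc ((1 + p′) * (1 + r))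
surplus-identity₁ = solve-∀

surplus-identity₂ : ∀ p′ t′ E q b m s →
  (2 + p′) * s + 1 + (2 + t′) * (q + E)
    + (b * q + m * (2 + p′) + (p′ * suc (q + E) + (2 + p′) * q))
    ≡ q * (2 + t′) + 2 * m + ((s + (q + E)) * (2 + p′) + (p′ * (q + m) + b * q)) + suc (p′ + t′ * E)
surplus-identity₂ = solve-∀

few-neighbours-identity : ∀ p′ r b m s k l D →
  (2 + p′) * s + 1 + (k * D + l * (suc D + r))
    + (b * (suc D + r) + m * (2 + p′) + (suc r * k + D * (2 + p′)))
    ≡ (suc D + r) * (k + l) + 2 * m + ((s + D) * (2 + p′) + (suc r * b + D * b)) + suc (p′ * m)
few-neighbours-identity = solve-∀

-- The two quadratics differ by `2(D - 1)² + c(2D + 2c - 3)`, which is non-negative for natural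
-- numbers though not for all reals. It vanishes only at `D = 1`, `c = 0`, where the term
-- `2 * (D + c)` pays for the `1`.
residual : ∀ N D c → suc N * (4 * D + 3 * c) + 1 ≤ suc N * (2 * D * D + 2 * D * c + 2 * c * c + 2) + 2 * (D + c)
residual N zero    zero    = ≤-trans (m≤m+n _ _) (≤-reflexive (identity N))
  where
  identity : ∀ N → suc N * 0 + 1 + (1 + 2 * N) ≡ suc N * 2 + 0
  identity = solve-∀
residual N zero    (suc c) = ≤-trans (m≤m+n _ _) (≤-reflexive (identity N c))
  where
  identity : ∀ N c → suc N * (3 * suc c) + 1 + (suc N * (1 + c + 2 * c * c) + 1 + 2 * c) ≡ suc N * (2 * suc c * suc c + 2) + 2 * suc c
  identity = solve-∀
residual N (suc D) zero    = ≤-trans (m≤m+n _ _) (≤-reflexive (identity N D))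
  where
  identity : ∀ N D → suc N * (4 * suc D + 0) + 1 + (suc N * (2 * D * D) + 1 + 2 * D)
             ≡ suc N * (2 * suc D * suc D + 2 * suc D * 0 + 0 + 2) + 2 * (suc D + 0)
  identity = solve-∀
residual N (suc D) (suc c) = ≤-trans (m≤m+n _ _) (≤-reflexive (identity N D c))
  where
  identity : ∀ N D c →
    suc N * (4 * suc D + 3 * suc c) + 1 + (suc N * (2 * D * D + 2 * D * suc c + 1 + 3 * c + 2 * c * c) + 3 + 2 * D + 2 * c)
      ≡ suc N * (2 * suc D * suc D + 2 * suc D * suc c + 2 * suc c * suc c + 2) + 2 * (suc D + suc c)
  identity = solve-∀

-- The coefficient of n collapses because (p + q)² = q N + p².
two-degrees-identity : ∀ p′ r′ D c s t i n m W →
  let p = 2 + p′; r = 1 + r′; q = D + c + r; A = p + q; N = p + A in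
  2 * N * (p * s + 1 + t * (D + c)) + (2 * N * r * (i + s + t) + ((p + r) * (2 * A * n)
    + (2 * p * (i * N) + (2 * (D + c) * suc ((p′ + q + 2 * m) * N)
    + (2 * N * W + (N * (4 * D + 3 * c) + 1))))))
  ≡ 2 * N * (q * t + W + suc D * c) + (2 * N * r * n + ((p + r) * ((2 * i + 2 * s + (D + (D + c))) * N)
    + (2 * p * (p * n) + (2 * (D + c) * (n * p)
    + (2 * N * (2 * m * (D + c)) + (N * (2 * D * D + 2 * D * c + 2 * c * c + 2) + 2 * (D + c)))))))
    + suc (N * c * (p′ + r′))
two-degrees-identity = solve-∀

-- The bound on `i` lets the leading term `p * n * p` absorb `i * N * p`; the common factor `N` then
-- cancels.
cancel-minimum-degree : ∀ {p n b q N m i s D} → 0 < N → i * N ≤ p * n →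
  p * n * p + b * q * N + m * N * p ≤ (i + s + D) * N * p → b * q + m * p ≤ (s + D) * p
cancel-minimum-degree {p} {n} {b} {q} {suc N} {m} {i} {s} {D} _ small degree =
  *-cancelʳ-≤ _ _ (suc N) (+-cancelˡ-≤ (p * n * p + i * suc N * p) _ _
    (subst₂ _≤_ (left p n b q (suc N) m i) (right p n (suc N) i s D) (degree ⊕ *-monoˡ-≤ p small)))
  where
  left : ∀ p n b q N m i → p * n * p + b * q * N + m * N * p + i * N * p ≡ p * n * p + i * N * p + (b * q + m * p) * N
  left = solve-∀
  right : ∀ p n N i s D → (i + s + D) * N * p + p * n * p ≡ p * n * p + i * N * p + (s + D) * p * N
  right = solve-∀

-- For a single vertex in `T`. Eliminating `s` leaves `(p - 1) * q < (p - 1) * h`, against `h < q`.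
surplus-absurd₁ : ∀ {p q b m} s h e → 2 ≤ p → p ≤ b → h < q → e ≤ m →
  p * s + 1 + h ≤ q → b * q + m * p ≤ (s + (h + e)) * p → ⊥
surplus-absurd₁ {b = b} {m} s h e 2≤p p≤b h<q e≤m deficit degree
  with m≤n⇒∃[o]m+o≡n 2≤p | m≤n⇒∃[o]m+o≡n h<q
... | p′ , refl | r , refl = 
  exceeds (deficit ⊕ degree ⊕ *-monoʳ-≤ (2 + p′) e≤m ⊕ *-monoˡ-≤ (suc h + r) p≤b)
    ((1 + p′) * (1 + r)) (surplus-identity₁ p′ r b m s h e)

-- With `D = q + E`, eliminating `s` leaves `p * (m - E) + 1 + t * E ≤ 2 * m`, impossible since
-- `E < m` and both `p` and `t` are at least 2.
surplus-absurd₂ : ∀ {p q b m} s t D → 2 ≤ p → p ≤ b → 2 ≤ t → q ≤ D → D < q + m →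
  p * s + 1 + t * D ≤ q * t + 2 * m → b * q + m * p ≤ (s + D) * p → ⊥
surplus-absurd₂ {q = q} {b} {m} s t D 2≤p p≤b 2≤t q≤D D<q+m deficit degree
  with m≤n⇒∃[o]m+o≡n 2≤p | m≤n⇒∃[o]m+o≡n 2≤t | m≤n⇒∃[o]m+o≡n q≤D
... | p′ , refl | t′ , refl | E , refl = 
  exceeds (deficit ⊕ degree ⊕ *-monoʳ-≤ p′ D<q+m ⊕ *-monoˡ-≤ q p≤b)
    (p′ + t′ * E) (surplus-identity₂ p′ t′ E q b m s)

-- The `l` far vertices cancel. The rest is settled by `k ≤ D + 1 ≤ q ≤ b`, which bounds
-- `k * (q - D)` by `b * (q - D)`.
few-neighbours-absurd : ∀ {p q b m} s k l D → 2 ≤ p → p ≤ b → q ≤ b → D < q → k ≤ suc D →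
  p * s + 1 + (k * D + l * q) ≤ q * (k + l) + 2 * m → b * q + m * p ≤ (s + D) * p → ⊥
few-neighbours-absurd {b = b} {m} s k l D 2≤p p≤b q≤b D<q k≤D+1 deficit degree
  with m≤n⇒∃[o]m+o≡n 2≤p | m≤n⇒∃[o]m+o≡n D<q
... | p′ , refl | r , refl =
  exceeds (deficit ⊕ degree ⊕ *-monoʳ-≤ (suc r) (≤-trans k≤D+1 (≤-trans D<q q≤b)) ⊕ *-monoʳ-≤ D p≤b)
    (p′ * m) (few-neighbours-identity p′ r b m s k l D)

-- Eliminating `t` by `sizes`, `s` by `ore` and `i` by `small` leaves `n` with the coefficient
-- `2 * p * (D + c)` on the smaller side; `large` then bounds it from below, and `residual` settles
-- the terms in `D` and `c`.
two-degrees-absurd : ∀ {p q} s t i n m W D c → 2 ≤ p → D + c < q →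
  p * s + 1 + t * (D + c) ≤ q * t + W + suc D * c → i + s + t ≤ n →
  2 * (p + q) * n ≤ (2 * i + 2 * s + (D + (D + c))) * (p + (p + q)) → i * (p + (p + q)) ≤ p * n →
  (p + q + 2 * m ∸ 2) * (p + (p + q)) < n * p → W ≤ 2 * m * (D + c) → ⊥
two-degrees-absurd s t i n m W D c 2≤p D+c<q deficit sizes ore small large W≤
  with m≤n⇒∃[o]m+o≡n 2≤p | m≤n⇒∃[o]m+o≡n D+c<q
-- Here `r = 1 + r′` is `q - (D + c)`, the net coefficient of `t` in `deficit`.
... | p′ , refl | r′ , q≡ with trans (≡-sym q≡) (≡-sym (+-suc (D + c) r′))
...   | refl = 
  exceeds (*-monoʳ-≤ (2 * N) deficit ⊕ *-monoʳ-≤ (2 * N * r) sizes ⊕ *-monoʳ-≤ (p + r) ore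
    ⊕ *-monoʳ-≤ (2 * p) small ⊕ *-monoʳ-≤ (2 * (D + c)) large ⊕ *-monoʳ-≤ (2 * N) W≤
    ⊕ residual (suc p′ + (p + (D + c + r))) D c)
    (N * c * (p′ + r′)) (two-degrees-identity p′ r′ D c s t i n m W)
  where
  p = 2 + p′
  r = 1 + r′
  N = p + (p + (D + c + r))

-- Counting in the graph

degreeSum : (H : ESet n) → (∀ u v → H u v ≡ H v u) → (∀ u → H u u ≡ false) →
            sumℕ (λ u → count (H u)) ≤ 2 * edgeCount H
degreeSum {n} H H-sym H-irrefl = begin
  sumℕ (λ u → count (H u))                        ≤⟨ sumℕ-mono (λ u → sumℕ-mono (λ v → pointwise u v)) ⟩
  sumℕ (λ u → sumℕ (λ v → up u v + up v u))       ≡⟨ sumℕ-cong (λ u → sumℕ-+ (up u) (λ v → up v u)) ⟩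
  sumℕ (λ u → sumℕ (up u) + sumℕ (λ v → up v u))  ≡⟨ sumℕ-+ (λ u → sumℕ (up u)) (λ u → sumℕ (λ v → up v u)) ⟩
  edgeCount H + sumℕ (λ u → sumℕ (λ v → up v u))  ≡⟨ cong (_+_ (edgeCount H)) (sumℕ-swap (λ u v → up v u)) ⟩
  edgeCount H + edgeCount H                       ≡⟨ cong (_+_ (edgeCount H)) (≡-sym (+-identityʳ _)) ⟩
  2 * edgeCount H                                 ∎
  where
  open ≤-Reasoning
  up : Fin n → Fin n → ℕ
  up u v = ⟦ ⌊ toℕ u <? toℕ v ⌋ ∧ H u v ⟧
  up-< : ∀ {u v} → toℕ u < toℕ v → up u v ≡ ⟦ H u v ⟧
  up-< {u} {v} u<v with toℕ u <? toℕ v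
  ... | yes _   = refl
  ... | no  u≮v = ⊥-elim (u≮v u<v)
  pointwise : ∀ u v → ⟦ H u v ⟧ ≤ up u v + up v u
  pointwise u v with <-cmp (toℕ u) (toℕ v)
  ... | tri< u<v _ _ = ≤-trans (≤-reflexive (≡-sym (up-< u<v))) (m≤m+n _ _)
  ... | tri≈ _ u≡v _ rewrite Fin.toℕ-injective u≡v | H-irrefl v = z≤n
  ... | tri> _ _ v<u rewrite H-sym u v = ≤-trans (≤-reflexive (≡-sym (up-< v<u))) (m≤n+m _ _)

-- The edges at `x` enter the degree sum twice: once in the degree of `x`, once spread over its
-- neighbours.
degree≤edgeCount : (H : ESet n) → (∀ u v → H u v ≡ H v u) → (∀ u → H u u ≡ false) →
                   ∀ x → count (H x) ≤ edgeCount H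
degree≤edgeCount {n} H H-sym H-irrefl x = *-cancelˡ-≤ 2 (begin
  2 * count (H x)                                       ≡⟨ cong (_+_ (count (H x))) (+-identityʳ _) ⟩
  count (H x) + count (H x)                             ≡⟨ cong (_+_ (count (H x))) (sumℕ-cong (λ u → cong ⟦_⟧ (H-sym x u))) ⟩
  count (H x) + sumℕ (λ u → ⟦ H u x ⟧)                  ≡⟨ cong (_+ sumℕ (λ u → ⟦ H u x ⟧)) (≡-sym at-x) ⟩
  sumℕ (λ u → count (H x) * δ x u) + sumℕ (λ u → ⟦ H u x ⟧) ≡⟨ ≡-sym (sumℕ-+ (λ u → count (H x) * δ x u) (λ u → ⟦ H u x ⟧)) ⟩
  sumℕ (λ u → count (H x) * δ x u + ⟦ H u x ⟧)          ≤⟨ sumℕ-mono pointwise ⟩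
  sumℕ (λ u → count (H u))                              ≤⟨ degreeSum H H-sym H-irrefl ⟩
  2 * edgeCount H                                       ∎)
  where
  open ≤-Reasoning
  at-x : sumℕ (λ u → count (H x) * δ x u) ≡ count (H x)
  at-x = trans (sumℕ-*ˡ (count (H x)) (δ x)) (trans (cong (count (H x) *_) (sumℕ-δ x)) (*-identityʳ _))
  pointwise : ∀ u → count (H x) * δ x u + ⟦ H u x ⟧ ≤ count (H u)
  pointwise u with x Fin.≟ u
  ... | yes refl rewrite H-irrefl x = ≤-reflexive (trans (+-identityʳ _) (*-identityʳ _))
  ... | no  _    rewrite *-zeroʳ (count (H x)) = term≤sumℕ (λ v → ⟦ H u v ⟧) x

-- The size of an independent set

module _ (G : Graph n) (I : VSet n) (indep : Independent G I) where

  independent-degree : ∀ u → I u ≡ true → deg G u + count I ≤ n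
  independent-degree u Iu = begin
    deg G u + count I                    ≡⟨ ≡-sym (sumℕ-+ (λ w → ⟦ adj G u w ⟧) (λ w → ⟦ I w ⟧)) ⟩
    sumℕ (λ w → ⟦ adj G u w ⟧ + ⟦ I w ⟧) ≤⟨ sumℕ-mono pointwise ⟩
    sumℕ {n} (λ _ → 1)                   ≡⟨ sumℕ-1 n ⟩
    n                                    ∎
    where
    open ≤-Reasoning
    pointwise : ∀ w → ⟦ adj G u w ⟧ + ⟦ I w ⟧ ≤ 1
    pointwise w with I w in Iw
    ... | true rewrite indep u w Iu Iw = ≤-refl
    ... | false with adj G u w
    ...   | true  = ≤-refl
    ...   | false = z≤n

  -- Two members of `I` are non-adjacent with degrees at most `n - |I|`, so the Ore condition gives
  -- the bound. If `I` has at most one vertex, `large` suffices.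
  independent-small : ∀ p A → p + A ≤ p * n →
    (∀ u v → u ≢ v → adj G u v ≡ false → 2 * A * n ≤ (deg G u + deg G v) * (p + A)) →
    count I * (p + A) ≤ p * n
  independent-small p A large ore with any? (λ u → I u Bool.≟ true)
  ... | no ∄u = ≤-trans (*-monoˡ-≤ (p + A) (sumOn≤const I {λ _ → 1} 0 (λ u Iu → ⊥-elim (∄u (u , Iu))))) z≤n
  ... | yes (u , Iu) with any? (λ v → (I v Bool.≟ true) ×-dec ¬? (u Fin.≟ v))
  ...   | no ∄v = ≤-trans (*-monoˡ-≤ (p + A) single) (≤-trans (≤-reflexive (*-identityˡ _)) large)
    where
    pointwise : ∀ v → ⟦ I v ⟧ ≤ δ u v
    pointwise v with I v in Iv | u Fin.≟ v
    ... | false | _       = z≤n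
    ... | true  | yes _   = ≤-refl
    ... | true  | no  u≢v = ⊥-elim (∄v (v , Iv , u≢v))
    single : count I ≤ 1
    single = ≤-trans (sumℕ-mono pointwise) (≤-reflexive (sumℕ-δ u))
  ...   | yes (v , Iv , u≢v) = *-cancelˡ-≤ 2 (+-cancelˡ-≤ (2 * A * n + (deg G u + deg G v) * (p + A)) _ _
      (subst₂ _≤_ (left p A n (deg G u) (deg G v) (count I)) (right p A n (deg G u) (deg G v))
        (ore u v u≢v (indep u v Iu Iv)
          ⊕ *-monoʳ-≤ (p + A) (independent-degree u Iu ⊕ independent-degree v Iv))))
    where
    left : ∀ p A n d e i → 2 * A * n + (p + A) * (d + i + (e + i)) ≡ 2 * A * n + (d + e) * (p + A) + 2 * (i * (p + A))
    left = solve-∀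
    right : ∀ p A n d e → (d + e) * (p + A) + (p + A) * (n + n) ≡ 2 * A * n + (d + e) * (p + A) + 2 * (p * n)
    right = solve-∀

-- Degrees relative to a disjoint cut

module CutCounting (G : Graph n) (I : VSet n) (H : ESet n) (H⊆ : EdgeSubset G I H) (S T : VSet n)
                   (T∩I : ∀ x → T x ≡ true → I x ≡ false) (T∩S : ∀ x → T x ≡ true → S x ≡ false) where

  B : Matrix n
  B = adjDel G I H

  S∖I : VSet n
  S∖I x = S x ∧ not (I x)

  D : Fin n → ℕ
  D x = out B S x + count (H x)

  near far : Fin n → VSet n
  near u w = T w ∧ (does (u Fin.≟ w) ∨ adj G u w)
  far  u w = T w ∧ not (does (u Fin.≟ w) ∨ adj G u w)

  -- A neighbour of `x` lies in `I`, in `S` but not in `I`, or outside both; in the last case its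
  -- edge is in `H` or survives in `B`.
  degree-bound : ∀ x → I x ≡ false → deg G x ≤ count I + count S∖I + D x
  degree-bound x Ix = begin
    deg G x
      ≤⟨ sumℕ-mono pointwise ⟩
    sumℕ (λ v → (⟦ I v ⟧ + ⟦ S∖I v ⟧) + (⟦ not (S v) ∧ B x v ⟧ + ⟦ H x v ⟧))
      ≡⟨ sumℕ-+ (λ v → ⟦ I v ⟧ + ⟦ S∖I v ⟧) (λ v → ⟦ not (S v) ∧ B x v ⟧ + ⟦ H x v ⟧) ⟩
    sumℕ (λ v → ⟦ I v ⟧ + ⟦ S∖I v ⟧) + sumℕ (λ v → ⟦ not (S v) ∧ B x v ⟧ + ⟦ H x v ⟧)
      ≡⟨ cong₂ _+_ (sumℕ-+ (λ v → ⟦ I v ⟧) (λ v → ⟦ S∖I v ⟧)) (sumℕ-+ (λ v → ⟦ not (S v) ∧ B x v ⟧) (λ v → ⟦ H x v ⟧)) ⟩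
    count I + count S∖I + D x
      ∎
    where
    open ≤-Reasoning
    cases : ∀ i s a h → ⟦ a ⟧ ≤ (⟦ i ⟧ + ⟦ s ∧ not i ⟧) + (⟦ not s ∧ ((not i ∧ a) ∧ not h) ⟧ + ⟦ h ⟧)
    cases _     _     false _     = z≤n
    cases true  _     true  _     = s≤s z≤n
    cases false true  true  _     = s≤s z≤n
    cases false false true  true  = ≤-refl
    cases false false true  false = ≤-refl
    pointwise : ∀ v → ⟦ adj G x v ⟧ ≤ (⟦ I v ⟧ + ⟦ S∖I v ⟧) + (⟦ not (S v) ∧ B x v ⟧ + ⟦ H x v ⟧)
    pointwise v rewrite Ix = cases (I v) (S v) (adj G x v) (H x v)

  -- Vertices of `T` avoid `S` and `I`, so each neighbour of `u` in `T` is counted by `D u`; the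
  -- successor accounts for `u` itself.
  near-bound : ∀ u → T u ≡ true → count (near u) ≤ suc (D u)
  near-bound u Tu = begin
    count (near u)
      ≤⟨ sumℕ-mono pointwise ⟩
    sumℕ (λ w → δ u w + (⟦ not (S w) ∧ B u w ⟧ + ⟦ H u w ⟧))
      ≡⟨ sumℕ-+ (δ u) (λ w → ⟦ not (S w) ∧ B u w ⟧ + ⟦ H u w ⟧) ⟩
    sumℕ (δ u) + sumℕ (λ w → ⟦ not (S w) ∧ B u w ⟧ + ⟦ H u w ⟧)
      ≡⟨ cong₂ _+_ (sumℕ-δ u) (sumℕ-+ (λ w → ⟦ not (S w) ∧ B u w ⟧) (λ w → ⟦ H u w ⟧)) ⟩
    suc (D u)
      ∎
    where
    open ≤-Reasoning
    cases : ∀ d a h → ⟦ d ∨ a ⟧ ≤ ⟦ d ⟧ + (⟦ a ∧ not h ⟧ + ⟦ h ⟧)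
    cases true  _     _     = s≤s z≤n
    cases false false _     = z≤n
    cases false true  true  = ≤-refl
    cases false true  false = ≤-refl
    pointwise : ∀ w → ⟦ near u w ⟧ ≤ δ u w + (⟦ not (S w) ∧ B u w ⟧ + ⟦ H u w ⟧)
    pointwise w with T w in Tw
    ... | false = z≤n
    ... | true rewrite T∩S w Tw | T∩I w Tw | T∩I u Tu = cases (does (u Fin.≟ w)) (adj G u w) (H u w)

  far-nonadjacent : ∀ u w → far u w ≡ true → T w ≡ true × u ≢ w × adj G u w ≡ false
  far-nonadjacent u w e with T w | u Fin.≟ w | adj G u w | e
  ... | true  | no u≢w | false | _  = refl , u≢w , refl
  ... | true  | no _   | true  | ()
  ... | true  | yes _  | _     | ()
  ... | false | _      | _     | ()

  sizes : count I + count S∖I + count T ≤ n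
  sizes = begin
    count I + count S∖I + count T
      ≡⟨ cong (_+ count T) (≡-sym (sumℕ-+ (λ x → ⟦ I x ⟧) (λ x → ⟦ S∖I x ⟧))) ⟩
    sumℕ (λ x → ⟦ I x ⟧ + ⟦ S∖I x ⟧) + count T
      ≡⟨ ≡-sym (sumℕ-+ (λ x → ⟦ I x ⟧ + ⟦ S∖I x ⟧) (λ x → ⟦ T x ⟧)) ⟩
    sumℕ (λ x → (⟦ I x ⟧ + ⟦ S∖I x ⟧) + ⟦ T x ⟧)
      ≤⟨ sumℕ-mono pointwise ⟩
    sumℕ {n} (λ _ → 1)
      ≡⟨ sumℕ-1 n ⟩
    n ∎
    where
    open ≤-Reasoning
    pointwise : ∀ x → (⟦ I x ⟧ + ⟦ S∖I x ⟧) + ⟦ T x ⟧ ≤ 1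
    pointwise x with T x in Tx
    ... | true rewrite T∩I x Tx | T∩S x Tx = ≤-refl
    ... | false with I x | S x
    ...   | true  | true  = ≤-refl
    ...   | true  | false = ≤-refl
    ...   | false | true  = ≤-refl
    ...   | false | false = z≤n

  H-irrefl : ∀ u → H u u ≡ false
  H-irrefl u with H u u in Huu
  ... | false = refl
  ... | true with proj₂ H⊆ u u Huu
  ...   | e rewrite irrefl G u with I u | e
  ...     | true  | ()
  ...     | false | ()

  deleted-total : sumOn T (λ x → count (H x)) ≤ 2 * edgeCount H
  deleted-total = ≤-trans (sumOn≤sumℕ T (λ x → count (H x))) (degreeSum H (proj₁ H⊆) H-irrefl)

  deleted-at : ∀ x → count (H x) ≤ edgeCount H
  deleted-at = degree≤edgeCount H (proj₁ H⊆) H-irrefl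

-- Excluding disjoint deficient cuts

module _ {n : ℕ} (G : Graph n) (p q b m : ℕ)
  (2≤p : 2 ≤ p) (p≤b : p ≤ b) (q≤b : q ≤ b) (0<q : 0 < q)
  (minimum-degree : ∀ v → p * n * p + b * q * (p + (p + q)) + m * (p + (p + q)) * p ≤ deg G v * (p + (p + q)) * p)
  (large : (p + q + 2 * m ∸ 2) * (p + (p + q)) < n * p)
  (ore : ∀ u v → u ≢ v → adj G u v ≡ false → 2 * (p + q) * n ≤ (deg G u + deg G v) * (p + (p + q)))
  (I : VSet n) (indep : Independent G I) (H : ESet n) (H⊆ : EdgeSubset G I H) (|H| : edgeCount H ≡ m)
  (lo hi : Fin n → ℕ) (lo-I : ∀ x → I x ≡ true → lo x ≡ 0) (lo≤q : ∀ x → lo x ≤ q) (p≤hi : ∀ x → p ≤ hi x)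
  where

  no-disjoint-cut : (T S : VSet n) → (∀ x → T x ≡ true → S x ≡ false × out (adjDel G I H) S x < lo x) →
    sumOn T lo ≤ sumOn S hi + sumOn T (out (adjDel G I H) S)
  no-disjoint-cut T S T-spec = ≮⇒≥ λ cut → absurd cut
    where
    T∩I : ∀ x → T x ≡ true → I x ≡ false
    T∩I x Tx = Bool.¬-not λ Ix → n≮0 (subst (_ <_) (lo-I x Ix) (proj₂ (T-spec x Tx)))
    open CutCounting G I H H⊆ S T T∩I (λ x Tx → proj₁ (T-spec x Tx))

    h e : Fin n → ℕ
    h   = out B S
    e x = count (H x)
    A N i s t : ℕ
    A = p + q
    N = p + A
    i = count I
    s = count S∖I
    t = count T

    small : i * N ≤ p * n
    small = independent-small G I indep p A (≤-trans N≤ (≤-trans (<⇒≤ large) (≤-reflexive (*-comm n p)))) ore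
      where
      -- The truncated factor is at least 1 because `p + q ≥ 3`.
      N≤ : N ≤ (p + q + 2 * m ∸ 2) * N
      N≤ = ≤-trans (≤-reflexive (≡-sym (*-identityˡ N)))
             (*-monoˡ-≤ N (∸-monoˡ-≤ 2 (≤-trans (+-mono-≤ 2≤p 0<q) (m≤m+n (p + q) (2 * m)))))

    degree : ∀ x → T x ≡ true → b * q + m * p ≤ (s + D x) * p
    degree x Tx = cancel-minimum-degree {p} {n} {b} {q} {N} {m} {i} {s} {D x} (≤-trans (s≤s z≤n) (≤-trans 2≤p (m≤m+n p A))) small
      (≤-trans (minimum-degree x) (*-monoˡ-≤ p (*-monoˡ-≤ N (degree-bound x (T∩I x Tx)))))

    absurd : sumOn S hi + sumOn T h < sumOn T lo → ⊥
    absurd cut with any? (λ x → T x Bool.≟ true)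
    ... | no ∄x = n≮0 (≤-trans cut (sumOn≤const T 0 (λ x Tx → ⊥-elim (∄x (x , Tx)))))
    ... | yes nonempty with argmin T D nonempty
    ...   | u , Tu , u-min = go (q ≤? D u)
      where
      ps≤ : p * s ≤ sumOn S hi
      ps≤ = ≤-trans (≤-reflexive (≡-sym (sumOn-const S∖I p))) (sumℕ-mono pointwise)
        where
        pointwise : ∀ x → (if S∖I x then p else 0) ≤ (if S x then hi x else 0)
        pointwise x with S x | I x
        ... | true  | false = p≤hi x
        ... | true  | true  = z≤n
        ... | false | _     = z≤n

      deficit : p * s + 1 + sumOn T h ≤ q * t
      deficit = begin
        -- The `1` records that the cut inequality is strict.
        p * s + 1 + sumOn T h        ≤⟨ +-monoˡ-≤ _ (+-monoˡ-≤ 1 ps≤) ⟩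
        sumOn S hi + 1 + sumOn T h   ≡⟨ cong (_+ sumOn T h) (+-comm (sumOn S hi) 1) ⟩
        suc (sumOn S hi + sumOn T h) ≤⟨ cut ⟩
        sumOn T lo                   ≤⟨ sumOn≤const T q (λ x _ → lo≤q x) ⟩
        q * t                        ∎
        where open ≤-Reasoning

      deficit-D : p * s + 1 + sumOn T D ≤ q * t + 2 * m
      deficit-D = begin
        p * s + 1 + sumOn T D                ≡⟨ cong (_+_ (p * s + 1)) (sumOn-+ T h e) ⟩
        p * s + 1 + (sumOn T h + sumOn T e)  ≡⟨ ≡-sym (+-assoc (p * s + 1) _ _) ⟩
        p * s + 1 + sumOn T h + sumOn T e    ≤⟨ deficit ⊕ deleted-total ⟩
        q * t + 2 * edgeCount H              ≡⟨ cong (λ m → q * t + 2 * m) |H| ⟩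
        q * t + 2 * m                        ∎
        where open ≤-Reasoning

      e≤m : e u ≤ m
      e≤m = ≤-trans (deleted-at u) (≤-reflexive |H|)
      h<q : h u < q
      h<q = ≤-trans (proj₂ (T-spec u Tu)) (lo≤q u)

      k l : ℕ
      k = count (near u)
      l = count (far u)

      t≡k+l : t ≡ k + l
      t≡k+l = sumOn-split T (λ w → does (u Fin.≟ w) ∨ adj G u w) (λ _ → 1)

      near⊆T : ∀ w → near u w ≡ true → T w ≡ true
      near⊆T w e with T w | e
      ... | true  | _ = refl
      ... | false | ()

      D-total : ∀ d → (∀ w → far u w ≡ true → d ≤ D w) → k * D u + l * d ≤ sumOn T D
      D-total d d≤ = begin
        k * D u + l * d                   ≡⟨ cong₂ _+_ (*-comm k (D u)) (*-comm l d) ⟩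
        D u * k + d * l                   ≤⟨ sumOn≥const (near u) (D u) (λ w e → u-min w (near⊆T w e)) ⊕ sumOn≥const (far u) d d≤ ⟩
        sumOn (near u) D + sumOn (far u) D ≡⟨ ≡-sym (sumOn-split T (λ w → does (u Fin.≟ w) ∨ adj G u w) D) ⟩
        sumOn T D                         ∎
        where open ≤-Reasoning

      dense : ∀ τ → t ≡ τ → q ≤ D u → ⊥
      dense zero          t≡0 _ = n≮0 (subst (1 ≤_) t≡0 (term≤sumOn T (λ _ → 1) Tu))
      -- For `t = 1` the loss of `2 * m` in `deficit-D` is too large, so `deficit` is used together
      -- with the sharper bound `e u ≤ m`.
      dense (suc zero)    t≡1 _ = surplus-absurd₁ s (h u) (e u) 2≤p p≤b h<q e≤m
        (≤-trans (+-monoʳ-≤ (p * s + 1) (term≤sumOn T h Tu))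
                 (≤-trans deficit (≤-reflexive (trans (cong (q *_) t≡1) (*-identityʳ q)))))
        (degree u Tu)
      dense (suc (suc τ)) t≡  q≤D = surplus-absurd₂ s t (D u) 2≤p p≤b
        (≤-trans (s≤s (s≤s z≤n)) (≤-reflexive (≡-sym t≡))) q≤D (+-mono-≤ h<q e≤m)
        (≤-trans (+-monoʳ-≤ (p * s + 1) (≤-trans (≤-reflexive (*-comm t (D u))) (sumOn≥const T (D u) u-min))) deficit-D)
        (degree u Tu)

      no-far : D u < q → (∀ w → far u w ≡ true → q ≤ D w) → ⊥
      no-far D<q q≤D = few-neighbours-absurd {m = m} s k l (D u) 2≤p p≤b q≤b D<q (near-bound u Tu)
        (subst (λ t → p * s + 1 + (k * D u + l * q) ≤ q * t + 2 * m) t≡k+l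
          (≤-trans (+-monoʳ-≤ (p * s + 1) (D-total q q≤D)) deficit-D))
        (degree u Tu)

      two-far : ∀ v → far u v ≡ true → (∀ w → far u w ≡ true → D v ≤ D w) → D v < q → ⊥
      two-far v far-v v-min Dv<q with far-nonadjacent u v far-v
      ... | Tv , u≢v , u≁v with m≤n⇒∃[o]m+o≡n (u-min v Tv)
      ...   | c , D+c≡Dv = finish (D v) refl
        where
        ore-uv : 2 * A * n ≤ (2 * i + 2 * s + (D u + (D u + c))) * N
        ore-uv = ≤-trans (ore u v u≢v u≁v) (*-monoˡ-≤ N (begin
          deg G u + deg G v                       ≤⟨ degree-bound u (T∩I u Tu) ⊕ degree-bound v (T∩I v Tv) ⟩
          i + s + D u + (i + s + D v)             ≡⟨ regroup i s (D u) (D v) ⟩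
          2 * i + 2 * s + (D u + D v)             ≡⟨ cong (λ d → 2 * i + 2 * s + (D u + d)) (≡-sym D+c≡Dv) ⟩
          2 * i + 2 * s + (D u + (D u + c))       ∎))
          where
          open ≤-Reasoning
          regroup : ∀ i s d d′ → i + s + d + (i + s + d′) ≡ 2 * i + 2 * s + (d + d′)
          regroup = solve-∀
        -- `W` stands for the loss from deleted edges, which must be at most `2 * m * D v`: zero if
        -- `D v` is zero, and `2 * m` otherwise.
        conclude : ∀ W → p * s + 1 + t * (D u + c) ≤ q * t + W + suc (D u) * c → W ≤ 2 * m * (D u + c) → ⊥
        conclude W deficit-W W≤ = two-degrees-absurd s t i n m W (D u) c 2≤p
          (subst (_< q) (≡-sym D+c≡Dv) Dv<q) deficit-W sizes ore-uv small large W≤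
        finish : ∀ d → D v ≡ d → ⊥
        finish zero    Dv≡0 = conclude 0 (begin
          p * s + 1 + t * (D u + c)      ≡⟨ cong (λ d → p * s + 1 + t * d) (trans D+c≡Dv Dv≡0) ⟩
          p * s + 1 + t * 0              ≡⟨ cong (_+_ (p * s + 1)) (*-zeroʳ t) ⟩
          p * s + 1 + 0                  ≤⟨ +-monoʳ-≤ (p * s + 1) z≤n ⟩
          p * s + 1 + sumOn T h          ≤⟨ deficit ⟩
          q * t                          ≡⟨ ≡-sym (+-identityʳ _) ⟩
          q * t + 0                      ≤⟨ m≤m+n _ _ ⟩
          q * t + 0 + suc (D u) * c      ∎) z≤n
          where open ≤-Reasoning
        finish (suc d) Dv≡ = conclude (2 * m) (begin
          p * s + 1 + t * (D u + c)                      ≡⟨ cong (λ t → p * s + 1 + t * (D u + c)) t≡k+l ⟩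
          p * s + 1 + (k + l) * (D u + c)                ≡⟨ regroup (p * s + 1) k l (D u) c ⟩
          -- Near vertices are only known to satisfy `D ≥ D u`; counting them with `D v` costs
          -- `k * c`, which is at most `suc (D u) * c`.
          p * s + 1 + (k * D u + l * (D u + c)) + k * c  ≤⟨ +-mono-≤ (+-monoʳ-≤ (p * s + 1) (D-total (D u + c) far≥)) (*-monoˡ-≤ c (near-bound u Tu)) ⟩
          p * s + 1 + sumOn T D + suc (D u) * c          ≤⟨ +-monoˡ-≤ _ deficit-D ⟩
          q * t + 2 * m + suc (D u) * c                  ∎)
          (m≤m*n′ (2 * m) (D u + c) (subst (0 <_) (≡-sym (trans D+c≡Dv Dv≡)) (s≤s z≤n)))
          where
          open ≤-Reasoning
          far≥ : ∀ w → far u w ≡ true → D u + c ≤ D w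
          far≥ w e = ≤-trans (≤-reflexive D+c≡Dv) (v-min w e)
          regroup : ∀ x k l d c → x + (k + l) * (d + c) ≡ x + (k * d + l * (d + c)) + k * c
          regroup = solve-∀
          m≤m*n′ : ∀ x y → 0 < y → x ≤ x * y
          m≤m*n′ x y 0<y = ≤-trans (≤-reflexive (≡-sym (*-identityʳ x))) (*-monoʳ-≤ x 0<y)

      go : Dec (q ≤ D u) → ⊥
      go (yes q≤D) = dense t refl q≤D
      go (no  q≰D) with any? (λ w → (far u w Bool.≟ true) ×-dec (D w <? q))
      ... | no ∄w = no-far (≰⇒> q≰D) (λ w far-w → ≮⇒≥ (λ Dw<q → ∄w (w , far-w , Dw<q)))
      ... | yes (w , far-w , Dw<q) with argmin (far u) D (w , far-w)
      ...   | v , far-v , v-min = two-far v far-v v-min (≤-trans (s≤s (v-min w far-w)) Dw<q)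

-- Translating the hypotheses

adjDel-sym : ∀ {n} (G : Graph n) (I : VSet n) (H : ESet n) → (∀ u v → H u v ≡ H v u) →
             ∀ u v → adjDel G I H u v ≡ adjDel G I H v u
adjDel-sym G I H H-sym u v rewrite H-sym u v | Graph.sym G u v = cong (_∧ not (H v u)) (swap (not (I u)) (not (I v)) (adj G v u))
  where
  swap : ∀ x y z → x ∧ y ∧ z ≡ y ∧ x ∧ z
  swap true  true  _ = refl
  swap true  false _ = refl
  swap false true  _ = refl
  swap false false _ = refl

-- The rational hypotheses are multiplied by their denominators, and the bound on the minimal degree
-- sum is stated for each non-adjacent pair.
theorem6 : (n : ℕ) (G : Graph n) (b Δ a m : ℕ) →
    a + Δ ≤ b → 2 ≤ a →
    (∀ v → (Δ + a) * n * (a + Δ) + b * (b ∸ Δ) * (b + 2 * a + Δ) + m * (b + 2 * a + Δ) * (a + Δ)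
    ≤ deg G v * (b + 2 * a + Δ) * (a + Δ)) →
    (b + 2 * m + a ∸ 2) * (b + Δ + 2 * a) < n * (Δ + a) →
    (g f : Fin n → ℤ) →
    (∀ x → (f x ℤ.- + Δ) ℤ.≤ (+ b ℤ.- + Δ)) →
    (∀ x → g x ℤ.≤ (f x ℤ.- + Δ)) →
    (∀ x → + a ℤ.≤ g x) →
    (∀ u v → u ≢ v → adj G u v ≡ false →
    2 * (b + a) * n ≤ (deg G u + deg G v) * (b + 2 * a + Δ)) →
    FractionalIDDeleted G g f m
theorem6 n G b Δ zero m p≤b () minDeg large g f f≤b g≤f a≤g ore I indep H H⊆ |H|
theorem6 n G b Δ (suc zero) m p≤b (s≤s ()) minDeg large g f f≤b g≤f a≤g ore I indep H H⊆ |H|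
theorem6 n G b Δ a@(suc (suc a′)) m p≤b _ minDeg large g f f≤b g≤f a≤g ore I indep H H⊆ |H| =
  symmetrised-factor G I H B-sym lo hi g f lo-spec f≡
    (degreeConstrained (adjDel G I H) B-sym lo hi lo≤hi
      (noDeficientCut (adjDel G I H) B-sym lo hi lo≤hi
        (no-disjoint-cut G p q b m (s≤s (s≤s z≤n)) p≤b (m∸n≤m b Δ) (≤-trans (s≤s z≤n) a≤q) minDeg′ large′ ore′ I indep H H⊆ |H|
          lo hi lo-I lo≤q p≤hi)))
  where
  p′ p q : ℕ
  p′ = a′ + Δ
  p  = 2 + p′
  q  = b ∸ Δ
  b≡ : b ≡ q + Δ
  b≡ = ≡-sym (m∸n+n≡m (≤-trans (m≤n+m Δ a) p≤b))
  a≤q : a ≤ q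
  a≤q = +-cancelʳ-≤ Δ a q (≤-trans p≤b (≤-reflexive b≡))
  N≡ : b + 2 * a + Δ ≡ p + (p + q)
  N≡ = trans (cong (λ b → b + 2 * a + Δ) b≡) (identity q a′ Δ)
    where
    identity : ∀ q a′ Δ → q + Δ + 2 * (2 + a′) + Δ ≡ 2 + (a′ + Δ) + (2 + (a′ + Δ) + q)
    identity = solve-∀
  minDeg′ : ∀ v → p * n * p + b * q * (p + (p + q)) + m * (p + (p + q)) * p ≤ deg G v * (p + (p + q)) * p
  minDeg′ v = subst₂ (λ x N → x * n * p + b * q * N + m * N * p ≤ deg G v * N * p) (+-comm Δ a) N≡ (minDeg v)
  -- Since `p` is `2 + p′` by computation, this is the bound with `p + q + 2 * m ∸ 2`.
  large′ : (p′ + q + 2 * m) * (p + (p + q)) < n * p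
  large′ = subst₂ _<_ (cong₂ _*_ first (trans second N≡)) (cong (n *_) (+-comm Δ a)) large
    where
    first : b + 2 * m + a ∸ 2 ≡ p′ + q + 2 * m
    first = trans (cong (λ b → b + 2 * m + a ∸ 2) b≡) (cong (_∸ 2) (identity q Δ m a′))
      where
      identity : ∀ q Δ m a′ → q + Δ + 2 * m + (2 + a′) ≡ 2 + (a′ + Δ + q + 2 * m)
      identity = solve-∀
    second : b + Δ + 2 * a ≡ b + 2 * a + Δ
    second = trans (+-assoc b Δ _) (trans (cong (_+_ b) (+-comm Δ (2 * a))) (≡-sym (+-assoc b (2 * a) Δ)))
  ore′ : ∀ u v → u ≢ v → adj G u v ≡ false → 2 * (p + q) * n ≤ (deg G u + deg G v) * (p + (p + q))
  ore′ u v u≢v u≁v = subst₂ (λ A N → 2 * A * n ≤ (deg G u + deg G v) * N) A≡ N≡ (ore u v u≢v u≁v)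
    where
    A≡ : b + a ≡ p + q
    A≡ = trans (cong (_+ a) b≡) (identity q Δ a′)
      where
      identity : ∀ q Δ a′ → q + Δ + (2 + a′) ≡ 2 + (a′ + Δ) + q
      identity = solve-∀
  B-sym : ∀ u v → adjDel G I H u v ≡ adjDel G I H v u
  B-sym = adjDel-sym G I H (proj₁ H⊆)

  cancel-Δ : ∀ z → z ℤ.- + Δ ℤ.+ + Δ ≡ z
  cancel-Δ z = trans (ℤ.+-assoc z (ℤ.- + Δ) (+ Δ)) (trans (cong (ℤ._+_ z) (ℤ.+-inverseˡ (+ Δ))) (ℤ.+-identityʳ z))
  g+Δ≤f : ∀ x → g x ℤ.+ + Δ ℤ.≤ f x
  g+Δ≤f x = subst (g x ℤ.+ + Δ ℤ.≤_) (cancel-Δ (f x)) (ℤ.+-monoˡ-≤ (+ Δ) (g≤f x))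
  f≤b′ : ∀ x → f x ℤ.≤ + b
  f≤b′ x = subst₂ ℤ._≤_ (cancel-Δ (f x)) (cancel-Δ (+ b)) (ℤ.+-monoˡ-≤ (+ Δ) (f≤b x))

  gℕ hi lo : Fin n → ℕ
  gℕ x = ℤ.∣ g x ∣
  hi x = ℤ.∣ f x ∣
  -- Vertices of `I` have no edges left, so they must carry no demand; this also keeps `T` away from
  -- `I`.
  lo x = if I x then 0 else gℕ x
  g≡ : ∀ x → g x ≡ + gℕ x
  g≡ x = ≡-sym (ℤ.0≤i⇒+∣i∣≡i (ℤ.≤-trans (ℤ.+≤+ z≤n) (a≤g x)))
  f≡ : ∀ x → f x ≡ + hi x
  f≡ x = ≡-sym (ℤ.0≤i⇒+∣i∣≡i (ℤ.≤-trans (ℤ.+≤+ z≤n) (subst (λ z → z ℤ.+ + Δ ℤ.≤ f x) (g≡ x) (g+Δ≤f x))))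
  g+Δ≤hi : ∀ x → gℕ x + Δ ≤ hi x
  g+Δ≤hi x = ℤ.drop‿+≤+ (subst₂ (λ y z → y ℤ.+ + Δ ℤ.≤ z) (g≡ x) (f≡ x) (g+Δ≤f x))
  p≤hi : ∀ x → p ≤ hi x
  p≤hi x = ≤-trans (+-monoˡ-≤ Δ (ℤ.drop‿+≤+ (subst (+ a ℤ.≤_) (g≡ x) (a≤g x)))) (g+Δ≤hi x)
  gℕ≤q : ∀ x → gℕ x ≤ q
  gℕ≤q x = +-cancelʳ-≤ Δ _ _ (≤-trans (g+Δ≤hi x)
    (≤-trans (ℤ.drop‿+≤+ (subst (ℤ._≤ + b) (f≡ x) (f≤b′ x))) (≤-reflexive b≡)))
  lo≤g : ∀ x → lo x ≤ gℕ x
  lo≤g x with I x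
  ... | true  = z≤n
  ... | false = ≤-refl
  lo≤q : ∀ x → lo x ≤ q
  lo≤q x = ≤-trans (lo≤g x) (gℕ≤q x)
  lo≤hi : ∀ x → lo x ≤ hi x
  lo≤hi x = ≤-trans (lo≤g x) (≤-trans (m≤m+n _ Δ) (g+Δ≤hi x))
  lo-I : ∀ x → I x ≡ true → lo x ≡ 0
  lo-I x Ix rewrite Ix = refl
  lo-spec : ∀ x → I x ≡ false → g x ≡ + lo x
  lo-spec x Ix rewrite Ix = g≡ x
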